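{- Let $n$ be a positive integer, $q=3^n$, $m=2n$, and let $f(x)=x^d$ with $d=(3^k+1)/2$, where $\gcd(k,2n)=1$, be the Coulter–Matthews planar function on $\mathbb F_{3^m}=\mathbb F_{q^2}$. Let $\mathcal U:=\{(x,y):y+y^q=f(x+x^q)\}\cup\{(\infty)\}$ (the unital of the unitary polarity of $\Pi(f)$ given by $(x,y)\mapsto L_{x^q,y^q}$, $(a)\mapsto N_{a^q}$, $(\infty)\mapsto L_\infty$), and let $\mathcal U_\theta:=\{(x,t\theta):x\in\mathbb F_{q^2},t\in\mathbb F_q\}\cup\{(\infty)\}$ with $\theta\in\mathbb F_{q^2}^*$ such that $\theta^{q+1}$ is a nonsquare in $\mathbb F_q$. Then the subgroups of the shift group $T$ of $\Pi(f)$ fixing $\mathcal U$ and fixing $\mathcal U_\theta$ have orders $3^{2n}$ and $3^{3n}$ respectively. Consequently $\mathcal U$ and $\mathcal U_\theta$ are inequivalent, i.e.\ no collineation of $\Pi(f)$ maps one onto the other.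
   Context: $\Pi(f)$ is the projective plane with points $(x,y)\in\mathbb F_{q^2}^2$ and $(a)$ for $a\in\mathbb F_{q^2}\cup\{\infty\}$, lines $L_{a,b}=\{(x,f(x+a)-b):x\in\mathbb F_{q^2}\}\cup\{(a)\}$, $N_a=\{(a,y):y\in\mathbb F_{q^2}\}\cup\{(\infty)\}$ ($a,b\in\mathbb F_{q^2}$), $L_\infty=\{(a):a\in\mathbb F_{q^2}\cup\{\infty\}\}$. The shift group $T$ consists of the collineations $\tau_{u,v}$ induced by $(x,y)\mapsto(x+u,y+v)$, $u,v\in\mathbb F_{q^2}$. A collineation is a bijection of points mapping lines onto lines. -}

module Defs where

open import Algebra.Bundles using (CommutativeRing)
open import Algebra.Apartness.Structures using (IsHeytingField)
import Algebra.Properties.Ring as RingProperties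
import Algebra.Properties.Semiring.Exp as Exp
open import Data.Empty using (⊥)
open import Data.Fin.Base using (Fin)
import Data.Nat.Base as ℕ
import Data.Nat.DivMod as ℕ
open import Data.Nat.Base using (ℕ)
open import Data.Product.Base using (∃; ∃-syntax; ∃₂; _×_; _,_; proj₁)
open import Data.Unit.Base using (⊤; tt)
open import Function.Base using (_∘_)
open import Function.Bundles using (Inverse; _↔_; mk↔ₛ′)
open import Level using (0ℓ)
open import Relation.Binary.Bundles using (Setoid)
import Relation.Binary.Construct.On as On
open import Relation.Binary.PropositionalEquality
open import Relation.Unary using (Pred; _∈_; _∩_; _≐_)

-- With propositional equality as ≈ and its negation as apartness, a Heyting
-- field is an ordinary (discrete) field; 0# ≢ 1# follows from invertible⇒#.
record FiniteField (N : ℕ) : Set₁ where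
  infixl 7 _*_
  infixl 6 _+_
  infix  8 -_
  field
    Carrier        : Set
    _+_ _*_        : Carrier → Carrier → Carrier
    -_             : Carrier → Carrier
    0# 1#          : Carrier
    isHeytingField : IsHeytingField _≡_ _≢_ _+_ _*_ -_ 0# 1#
    enumeration    : Carrier ↔ Fin N

  open IsHeytingField isHeytingField public using (isCommutativeRing)

  commutativeRing : CommutativeRing 0ℓ 0ℓ
  commutativeRing = record { isCommutativeRing = isCommutativeRing }

  open CommutativeRing commutativeRing public
    using (_-_; ring; semiring; +-assoc; +-comm; +-identityʳ; -‿inverseˡ; -‿inverseʳ)
  open Exp semiring public using (_^_)

  -- The subfield of order q, when N is a power of q: the fixed points of the
  -- q-Frobenius map.
  𝔽 : ℕ → Pred Carrier 0ℓ
  𝔽 q t = t ^ q ≡ t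

  SquareIn : Pred Carrier 0ℓ → Pred Carrier 0ℓ
  SquareIn K t = ∃[ s ] s ∈ K × t ≡ s * s

-- The division by 2 is exact, 3 ^ k being odd.
coulterMatthews : ∀ {N} (F : FiniteField N) → ℕ → let open FiniteField F in Carrier → Carrier
coulterMatthews F k x = x ^ ((3 ℕ.^ k ℕ.+ 1) ℕ./ 2)
  where open FiniteField F

module Plane {N : ℕ} (F : FiniteField N) (f : FiniteField.Carrier F → FiniteField.Carrier F) where

  open FiniteField F

  -- The points (x , y), (a) and (∞).
  data Point : Set where
    aff   : (x y : Carrier) → Point
    slope : (a : Carrier) → Point
    ∞     : Point

  data Line : Set where
    L  : (a b : Carrier) → Line
    N′ : (a : Carrier) → Line
    L∞ : Line

  pointsOf : Line → Pred Point 0ℓ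
  pointsOf (L a b) (aff x y) = y ≡ f (x + a) - b
  pointsOf (L a b) (slope c) = c ≡ a
  pointsOf (L a b) ∞         = ⊥
  pointsOf (N′ a)  (aff x y) = x ≡ a
  pointsOf (N′ a)  (slope c) = ⊥
  pointsOf (N′ a)  ∞         = ⊤
  pointsOf L∞      (aff x y) = ⊥
  pointsOf L∞      (slope c) = ⊤
  pointsOf L∞      ∞         = ⊤

  image : (Point → Point) → Pred Point 0ℓ → Pred Point 0ℓ
  image h S Q = ∃[ P ] P ∈ S × h P ≡ Q

  record Collineation : Set where
    field
      bijection      : Point ↔ Point
    open Inverse bijection public using (to)
    field
      linesOntoLines : ∀ ℓ → ∃[ ℓ′ ] image to (pointsOf ℓ) ≐ pointsOf ℓ′

  open Collineation using (to)

  MapsOnto : Collineation → Pred Point 0ℓ → Pred Point 0ℓ → Set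
  MapsOnto g S S′ = image (to g) S ≐ S′

  -- Collineations are compared as maps on points.
  collineationSetoid : Setoid 0ℓ 0ℓ
  collineationSetoid = On.setoid (Point →-setoid Point) to

  open Setoid collineationSetoid using () renaming (_≈_ to _≋_)

  HasOrder : Pred Collineation 0ℓ → ℕ → Set
  HasOrder G m = Inverse (On.setoid collineationSetoid (proj₁ {B = G})) (setoid (Fin m))

  private
    module R = RingProperties ring

    +-cancel : ∀ x u → x + u + - u ≡ x
    +-cancel x u = trans (+-assoc x u (- u)) (trans (cong (x +_) (-‿inverseʳ u)) (+-identityʳ x))

    +-cancel′ : ∀ x u → x + - u + u ≡ x
    +-cancel′ x u = trans (+-assoc x (- u) u) (trans (cong (x +_) (-‿inverseˡ u)) (+-identityʳ x))

    +-shift : ∀ x u a → (x + u) + (a - u) ≡ x + a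
    +-shift x u a = trans (+-assoc x u (a - u))
      (cong (x +_) (trans (+-comm u (a - u)) (+-cancel′ a u)))

    sub-shift : ∀ z b v → z - b + v ≡ z - (b - v)
    sub-shift z b v = trans (+-assoc z (- b) v) (cong (z +_)
      (trans (cong (- b +_) (sym (R.-‿involutive v))) (R.-‿+-comm b (- v))))

  -- The action of τ u v on points and lines; on the line at infinity it is
  -- forced by the action on affine points.
  shiftPoint : Carrier → Carrier → Point → Point
  shiftPoint u v (aff x y) = aff (x + u) (y + v)
  shiftPoint u v (slope a) = slope (a - u)
  shiftPoint u v ∞         = ∞

  shiftLine : Carrier → Carrier → Line → Line
  shiftLine u v (L a b) = L (a - u) (b - v)
  shiftLine u v (N′ a)  = N′ (a + u)
  shiftLine u v L∞      = L∞

  private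
    unshift : ∀ u v P → shiftPoint u v (shiftPoint (- u) (- v) P) ≡ P
    unshift u v (aff x y) = cong₂ aff (+-cancel′ x u) (+-cancel′ y v)
    unshift u v (slope a) = cong slope (+-cancel′ a (- u))
    unshift u v ∞         = refl

    unshift′ : ∀ u v P → shiftPoint (- u) (- v) (shiftPoint u v P) ≡ P
    unshift′ u v (aff x y) = cong₂ aff (+-cancel x u) (+-cancel y v)
    unshift′ u v (slope a) = cong slope (+-cancel a (- u))
    unshift′ u v ∞         = refl

    unshiftLine : ∀ u v ℓ → shiftLine (- u) (- v) (shiftLine u v ℓ) ≡ ℓ
    unshiftLine u v (L a b) = cong₂ L (+-cancel a (- u)) (+-cancel b (- v))
    unshiftLine u v (N′ a)  = cong N′ (+-cancel a u)
    unshiftLine u v L∞      = refl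

    shift-incident : ∀ u v ℓ P → P ∈ pointsOf ℓ → shiftPoint u v P ∈ pointsOf (shiftLine u v ℓ)
    shift-incident u v (L a b) (aff x y) p = trans (cong (_+ v) p)
      (trans (cong (λ z → f z - b + v) (sym (+-shift x u a))) (sub-shift _ b v))
    shift-incident u v (L a b) (slope c) p = cong (_- u) p
    shift-incident u v (N′ a)  (aff x y) p = cong (_+ u) p
    shift-incident u v (N′ a)  ∞         p = tt
    shift-incident u v L∞      (slope c) p = tt
    shift-incident u v L∞      ∞         p = tt

  τ : Carrier → Carrier → Collineation
  τ u v = record
    { bijection      = mk↔ₛ′ (shiftPoint u v) (shiftPoint (- u) (- v)) (unshift u v) (unshift′ u v)
    ; linesOntoLines = λ ℓ → shiftLine u v ℓ
        , (λ { (P , P∈ℓ , refl) → shift-incident u v ℓ P P∈ℓ })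
        , λ {Q} Q∈ → shiftPoint (- u) (- v) Q
            , subst (λ ℓ′ → shiftPoint (- u) (- v) Q ∈ pointsOf ℓ′) (unshiftLine u v ℓ)
                (shift-incident (- u) (- v) (shiftLine u v ℓ) Q Q∈)
            , unshift u v Q
    }

  T : Pred Collineation 0ℓ
  T g = ∃₂ λ u v → g ≋ τ u v

  Fixing : Pred Point 0ℓ → Pred Collineation 0ℓ
  Fixing S g = MapsOnto g S S

  ShiftStabiliser : Pred Point 0ℓ → Pred Collineation 0ℓ
  ShiftStabiliser S = T ∩ Fixing S

  Equivalent : Pred Point 0ℓ → Pred Point 0ℓ → Set
  Equivalent S S′ = ∃[ g ] MapsOnto g S S′

  𝒰 : ℕ → Pred Point 0ℓ
  𝒰 q (aff x y) = y + y ^ q ≡ f (x + x ^ q)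
  𝒰 q (slope a) = ⊥
  𝒰 q ∞         = ⊤

  polarity : ℕ → Point → Line
  polarity q (aff x y) = L (x ^ q) (y ^ q)
  polarity q (slope a) = N′ (a ^ q)
  polarity q ∞         = L∞

  𝒰≐absolutePoints : ∀ q → 𝒰 q ≐ (λ P → P ∈ pointsOf (polarity q P))
  𝒰≐absolutePoints q = (λ {P} → there P) , λ {P} → back P
    where
    there : ∀ P → P ∈ 𝒰 q → P ∈ pointsOf (polarity q P)
    there (aff x y) p = trans (sym (+-cancel y (y ^ q))) (cong (_- y ^ q) p)
    there ∞         p = tt
    back : ∀ P → P ∈ pointsOf (polarity q P) → P ∈ 𝒰 q
    back (aff x y) p = trans (cong (_+ y ^ q) p) (+-cancel′ _ (y ^ q))
    back ∞         p = tt

  𝒰[_] : Carrier → ℕ → Pred Point 0ℓ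
  𝒰[ θ ] q (aff x y) = ∃[ t ] t ∈ 𝔽 q × y ≡ t * θ
  𝒰[ θ ] q (slope a) = ⊥
  𝒰[ θ ] q ∞         = ⊤

{-# OPTIONS --safe #-}
-- For f even, every tangent of 𝒰 is the polar of its foot: an affine line meets 𝒰
-- in a set preserved by two involutions, and the foot of a tangent must be fixed by
-- both. Hence the feet of the tangents to 𝒰 through a point P all lie on the polar of
-- P, and collineations preserve this collinearity. For 𝒰[ θ ], f takes values in
-- 𝔽 q · θ only at 0, because its values are squares and θ is not; so L a b with
-- b ∈ 𝔽 q · θ is tangent at (− a , − b). If f a and f b are congruent modulo 𝔽 q · θ,
-- a ≢ 0 and b ≢ ± a, then the tangents through (0 , f a) with feet over x = − a, a
-- and − b have feet that are not collinear, since f is two-to-one.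
module Submission where

open import Defs
open import Algebra.Apartness.Structures using (IsHeytingField)
open import Algebra.Bundles using (CommutativeMonoid; CommutativeRing; RawRing)
import Algebra.Definitions.RawMonoid as RawMonoid
import Algebra.Properties.CommutativeMonoid.Sum as Sum
import Algebra.Properties.CommutativeSemiring.Exp as CExp
import Algebra.Properties.Ring as RingProperties
import Algebra.Properties.Semiring.Mult as Mult
import Algebra.Solver.Ring as RingSolver
open import Algebra.Solver.Ring.AlmostCommutativeRing
  using (fromCommutativeRing; _-Raw-AlmostCommutative⟶_)
open import Data.Empty using (⊥; ⊥-elim)
open import Data.Fin.Base as Fin using (Fin; zero; suc; punchOut; combine; remQuot)
open import Data.Fin.Patterns using (0F; 1F; 2F)
import Data.Fin.Permutation as Perm
import Data.Fin.Properties as Fin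
open import Data.List.Base using (List; filter; allFin; lookup; length)
open import Data.List.Membership.Propositional using () renaming (_∈_ to _∈ˡ_)
import Data.List.Membership.Propositional.Properties as ∈ˡ
import Data.List.Relation.Unary.All as All
open import Data.List.Relation.Unary.AllPairs using (_∷_)
import Data.List.Relation.Unary.Any as Any
import Data.List.Relation.Unary.Any.Properties as Any
open import Data.List.Relation.Unary.Unique.Propositional using (Unique)
import Data.List.Relation.Unary.Unique.Propositional.Properties as Unique
open import Data.Maybe.Base using (Maybe; just; nothing)
open import Data.Nat as ℕ using (ℕ; zero; suc; NonZero)
import Data.Nat.Divisibility as ℕ
import Data.Nat.DivMod as ℕ
open import Data.Nat.GCD as GCD using (gcd)
import Data.Nat.Properties as ℕ
import Data.Nat.Solver as ℕ
open import Data.Product using (_×_; _,_; ∃; ∃-syntax; ∃₂; proj₁; proj₂; map₂)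
open import Data.Product.Function.NonDependent.Propositional using (_×-↔_)
open import Data.Sum using (_⊎_; inj₁; inj₂; [_,_]′)
open import Data.Sum.Function.Propositional using (_⊎-↔_)
open import Data.Unit using (⊤; tt)
open import Function.Base using (_∘_; id)
open import Function.Bundles using (Inverse; _↔_; mk↔ₛ′; mk↣)
open import Function.Definitions using (Injective)
open import Function.Properties.Inverse using (↔-sym; ↔-trans)
open import Level using (0ℓ)
open import Relation.Binary.Definitions using (DecidableEquality; tri<; tri≈; tri>)
open import Relation.Binary.PropositionalEquality
open import Relation.Nullary using (¬_; yes; no; contradiction)
open import Relation.Nullary.Decidable using (via-injection)
open import Relation.Unary using (Pred; Decidable; _∈_; _∉_; _⊆_; _⟨×⟩_; U)
open ≡-Reasoning

-- The two stabiliser orders differ, but that alone gives inequivalence only when `T` is known to be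
-- normal among all collineations, so that a collineation between the sets conjugates one stabiliser
-- into the other. Collinearity of feet is stated in terms of points and lines alone, so every
-- collineation respects it, and nothing about the full group has to be known. Its price is that
-- lines must be pulled back along a collineation, which by definition only pushes them forward;
-- finiteness of the plane closes this gap. The two-to-one property rests on the exponent: `k` is
-- odd, since it is prime to the even number 2n, and so (3 ^ k + 1) / 2 is 2 modulo 4. This makes
-- `f` an even function with square values and leaves x / y = 1 or - 1 as the only quotients when f
-- x = f y. In characteristic 3 one has 2 = - 1, so halving is a change of sign; this explains the
-- minus signs in the witnesses below.

-- Counting the elements of a predicate

record Enumeration {A : Set} (P : Pred A 0ℓ) (m : ℕ) : Set where
  field
    at           : Fin m → A
    at-∈         : ∀ i → at i ∈ P
    at-injective : Injective _≡_ _≡_ at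
    index        : ∀ {x} → x ∈ P → Fin m
    at-index     : ∀ {x} (p : x ∈ P) → at (index p) ≡ x

  index-at : ∀ i (p : at i ∈ P) → index p ≡ i
  index-at i p = at-injective (at-index p)

  -- Injectivity of `at` makes the index independent of the membership proof. Thus predicates with
  -- many proofs, such as `Fixing S`, can be counted without being propositions.
  index-cong : ∀ {x y} (p : x ∈ P) (p′ : y ∈ P) → x ≡ y → index p ≡ index p′
  index-cong p p′ x≡y = at-injective (trans (at-index p) (trans x≡y (sym (at-index p′))))

  index-injective : ∀ {x y} (p : x ∈ P) (p′ : y ∈ P) → index p ≡ index p′ → x ≡ y
  index-injective p p′ eq = trans (sym (at-index p)) (trans (cong at eq) (at-index p′))

open Enumeration

module _ {A B : Set} {P : Pred A 0ℓ} {Q : Pred B 0ℓ} where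

  Enumeration-transport : ∀ {m} (to : A → B) (from : B → A) →
    (∀ {x} → x ∈ P → to x ∈ Q) → (∀ {y} → y ∈ Q → from y ∈ P) →
    (∀ {x} → x ∈ P → from (to x) ≡ x) → (∀ {y} → y ∈ Q → to (from y) ≡ y) →
    Enumeration P m → Enumeration Q m
  Enumeration-transport to from to-∈ from-∈ from-to to-from e = record
    { at           = to ∘ at e
    ; at-∈         = to-∈ ∘ at-∈ e
    ; at-injective = λ {i} {j} eq → at-injective e
        (trans (sym (from-to (at-∈ e i))) (trans (cong from eq) (from-to (at-∈ e j))))
    ; index        = index e ∘ from-∈
    ; at-index     = λ q → trans (cong to (at-index e (from-∈ q))) (to-from q)
    }

  Enumeration-× : ∀ {m k} → Enumeration P m → Enumeration Q k →
                  Enumeration (P ⟨×⟩ Q) (m ℕ.* k)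
  Enumeration-× {m} {k} e e′ = record
    { at           = pair ∘ remQuot {m} k
    ; at-∈         = λ i → at-∈ e _ , at-∈ e′ _
    ; at-injective = λ {i} {j} eq → trans (sym (Fin.combine-remQuot {m} k i)) (trans
        (cong₂ combine (at-injective e (cong proj₁ eq)) (at-injective e′ (cong proj₂ eq)))
        (Fin.combine-remQuot {m} k j))
    ; index        = λ (p , q) → combine (index e p) (index e′ q)
    ; at-index     = λ (p , q) → trans (cong pair (Fin.remQuot-combine (index e p) (index e′ q)))
        (cong₂ _,_ (at-index e p) (at-index e′ q))
    }
    where
    pair : Fin m × Fin k → A × B
    pair (i , j) = at e i , at e′ j

Enumeration-unique : ∀ {A : Set} {P : Pred A 0ℓ} {m k} → Enumeration P m → Enumeration P k → m ≡ k
Enumeration-unique e e′ = Perm.↔⇒≡ (mk↔ₛ′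
  (index e′ ∘ at-∈ e) (index e ∘ at-∈ e′)
  (λ i → trans (index-cong e′ _ (at-∈ e′ i) (at-index e _)) (index-at e′ i _))
  (λ i → trans (index-cong e _ (at-∈ e i) (at-index e′ _)) (index-at e i _)))

↔⇒Enumeration : ∀ {A : Set} {m} → A ↔ Fin m → Enumeration {A} U m
↔⇒Enumeration e = record
  { at           = E.from
  ; at-∈         = λ _ → tt
  ; at-injective = λ {i} {j} eq → trans (sym (E.strictlyInverseˡ i))
      (trans (cong E.to eq) (E.strictlyInverseˡ j))
  ; index        = λ {x} _ → E.to x
  ; at-index     = λ {x} _ → E.strictlyInverseʳ x
  }
  where module E = Inverse e

lookup-injective : ∀ {A : Set} {xs : List A} → Unique xs → Injective _≡_ _≡_ (lookup xs)
lookup-injective (p ∷ u) {zero}  {zero}  eq = refl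
lookup-injective (p ∷ u) {zero}  {suc j} eq = contradiction eq (All.lookup p (∈ˡ.∈-lookup j))
lookup-injective (p ∷ u) {suc i} {zero}  eq = contradiction (sym eq) (All.lookup p (∈ˡ.∈-lookup i))
lookup-injective (p ∷ u) {suc i} {suc j} eq = cong suc (lookup-injective u eq)

-- The size stays unknown here; for the subfield `𝔽 q` it is determined afterwards, by comparing
-- squares.
enumerateDecidable : ∀ {m} {P : Pred (Fin m) 0ℓ} → Decidable P → ∃ (Enumeration P)
enumerateDecidable {m} {P} P? = length xs , record
  { at           = lookup xs
  ; at-∈         = λ i → proj₂ (∈ˡ.∈-filter⁻ P? {xs = allFin m} (∈ˡ.∈-lookup i))
  ; at-injective = lookup-injective (Unique.filter⁺ P? (Unique.allFin⁺ m))
  ; index        = λ {x} → Any.index ∘ ∈xs {x}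
  ; at-index     = λ p → sym (Any.lookup-index (∈xs p))
  }
  where
  xs : List (Fin m)
  xs = filter P? (allFin m)
  ∈xs : ∀ {x} → x ∈ P → x ∈ˡ xs
  ∈xs {x} = ∈ˡ.∈-filter⁺ P? (∈ˡ.∈-allFin x)

-- Punching out a missed value would inject `Fin (suc m)` into `Fin m`.
injective⇒surjective : ∀ {m} {f : Fin m → Fin m} → Injective _≡_ _≡_ f → ∀ j → ∃[ i ] f i ≡ j
injective⇒surjective {suc m} {f} f-inj j with Fin.any? (λ i → f i Fin.≟ j)
... | yes hit = hit
... | no miss = contradiction
  (Fin.injective⇒≤ {f = λ i → punchOut (j≢f i)}
    (λ {x} {y} → f-inj ∘ Fin.punchOut-injective (j≢f x) (j≢f y)))
  ℕ.1+n≰n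
  where
  j≢f : ∀ i → j ≢ f i
  j≢f i = miss ∘ (i ,_) ∘ sym

module _ {c} (M : CommutativeMonoid c 0ℓ) where
  open CommutativeMonoid M using (_≈_; ∙-congˡ; identityʳ; ε)
    renaming (trans to ≈-trans)
  open Sum M using (sum; sum-remove; sum-cong-≋; sum-replicate-zero)

  sum-at : ∀ {m} (i : Fin m) t → (∀ j → j ≢ i → t j ≈ ε) → sum t ≈ t i
  sum-at {suc m} i t t≈ε = ≈-trans (sum-remove {i = i} t) (≈-trans
    (∙-congˡ (≈-trans (sum-cong-≋ (λ j → t≈ε _ (Fin.punchInᵢ≢i i j))) (sum-replicate-zero m)))
    (identityʳ _))

-- Finite fields of order `N`

module FiniteFieldProperties {N : ℕ} (F : FiniteField N) where

  open FiniteField F public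
  open CommutativeRing commutativeRing public
    using ( +-identityˡ; *-assoc; *-comm; *-identityˡ; *-identityʳ; distribʳ; zeroˡ; zeroʳ
          ; +-commutativeMonoid; *-commutativeMonoid; commutativeSemiring)
  open CExp commutativeSemiring public using (^-homo-*; ^-assocʳ; ^-distrib-*; ^-congʳ)
  open RingProperties ring public
    using (-‿involutive; -‿+-comm; -‿distribˡ-*; -‿distribʳ-*; -0#≈0#)

  module enumeration = Inverse enumeration

  elements : Enumeration {Carrier} U N
  elements = ↔⇒Enumeration enumeration

  infix 4 _≟_
  _≟_ : DecidableEquality Carrier
  _≟_ = via-injection (mk↣ {to = enumeration.to} (index-injective elements _ _)) Fin._≟_

  inverse : ∀ {x} → x ≢ 0# → ∃[ y ] x * y ≡ 1#
  inverse {x} x≢0 with IsHeytingField.#⇒invertible isHeytingField x≢0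
  ... | y , _ , p = y , trans (cong (_* y) (sym (trans (cong (x +_) -0#≈0#) (+-identityʳ x)))) p

  *-cancelˡ : ∀ {x y z} → x ≢ 0# → x * y ≡ x * z → y ≡ z
  *-cancelˡ {x} {y} {z} x≢0 eq with x′ , xx′ ← inverse x≢0 =
    trans (unit y) (trans (cong (x′ *_) eq) (sym (unit z)))
    where
    unit : ∀ w → w ≡ x′ * (x * w)
    unit w = sym (trans (sym (*-assoc x′ x w))
      (trans (cong (_* w) (trans (*-comm x′ x) xx′)) (*-identityˡ w)))

  *-≢0 : ∀ {x y} → x ≢ 0# → y ≢ 0# → x * y ≢ 0#
  *-≢0 {x} x≢0 y≢0 xy≡0 = y≢0 (*-cancelˡ x≢0 (trans xy≡0 (sym (zeroʳ x))))

  0≢1 : 0# ≢ 1#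
  0≢1 0≡1 = IsHeytingField.invertible⇒# isHeytingField {1#} {1#}
    (1# , trans (*-comm _ _) z , z) refl
    where
    z : (1# - 1#) * 1# ≡ 1#
    z = trans (*-identityʳ _) (trans (-‿inverseʳ 1#) 0≡1)

  +-cancelˡ : ∀ x {y z} → x + y ≡ x + z → y ≡ z
  +-cancelˡ x {y} {z} eq = trans (sym (unit y)) (trans (cong (- x +_) eq) (unit z))
    where
    unit : ∀ w → - x + (x + w) ≡ w
    unit w = trans (sym (+-assoc (- x) x w)) (trans (cong (_+ w) (-‿inverseˡ x)) (+-identityˡ w))

  permutation : (h h⁻¹ : Carrier → Carrier) → (∀ x → h (h⁻¹ x) ≡ x) → (∀ x → h⁻¹ (h x) ≡ x) →
                Perm.Permutation N N
  permutation h h⁻¹ hh⁻¹ h⁻¹h = Perm.permutation (onIndices h) (onIndices h⁻¹)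
    (inv h h⁻¹ hh⁻¹) (inv h⁻¹ h h⁻¹h)
    where
    onIndices : (Carrier → Carrier) → Fin N → Fin N
    onIndices g i = enumeration.to (g (enumeration.from i))
    inv : ∀ g g′ → (∀ x → g (g′ x) ≡ x) → ∀ i → onIndices g (onIndices g′ i) ≡ i
    inv g g′ gg′ i = trans (cong (enumeration.to ∘ g) (enumeration.strictlyInverseʳ _))
      (trans (cong enumeration.to (gg′ _)) (enumeration.strictlyInverseˡ i))

  module _ (M : CommutativeMonoid 0ℓ 0ℓ) where
    open CommutativeMonoid M using (_≈_)
      renaming (Carrier to A; trans to ≈-trans; reflexive to ≈-reflexive)
    open Sum M using (sum; sum-permute; sum-cong-≗)

    sum-reindex : ∀ (g : Carrier → A) h h⁻¹ → (∀ x → h (h⁻¹ x) ≡ x) → (∀ x → h⁻¹ (h x) ≡ x) →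
                  sum (g ∘ enumeration.from) ≈ sum (g ∘ h ∘ enumeration.from)
    sum-reindex g h h⁻¹ p q = ≈-trans (sum-permute (g ∘ enumeration.from) (permutation h h⁻¹ p q))
      (≈-reflexive (sum-cong-≗ {N} (λ i → cong g (enumeration.strictlyInverseʳ _))))

  open RawMonoid (CommutativeMonoid.rawMonoid +-commutativeMonoid) using () renaming (_×_ to _·_)

  -- Adding 1 permutes the field, so the sum S of all elements satisfies S = S + N · 1.
  N·1≡0 : N · 1# ≡ 0#
  N·1≡0 = +-cancelˡ (sum enumeration.from) (trans (cong (sum enumeration.from +_) (sym (sum-replicate N)))
    (trans (sym (∑-distrib-+ enumeration.from (λ _ → 1#)))
    (trans (sym (sum-reindex +-commutativeMonoid id (_+ 1#) (_- 1#)
       (λ x → trans (+-assoc x (- 1#) 1#) (trans (cong (x +_) (-‿inverseˡ 1#)) (+-identityʳ x)))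
       (λ x → trans (+-assoc x 1# (- 1#)) (trans (cong (x +_) (-‿inverseʳ 1#)) (+-identityʳ x)))))
    (sym (+-identityʳ _)))))
    where
    open Sum +-commutativeMonoid

  product-≢0 : ∀ {m} (t : Fin m → Carrier) → (∀ i → t i ≢ 0#) → Sum.sum *-commutativeMonoid t ≢ 0#
  product-≢0 {zero}  t t≢0 = 0≢1 ∘ sym
  product-≢0 {suc m} t t≢0 = *-≢0 (t≢0 zero) (product-≢0 (t ∘ suc) (t≢0 ∘ suc))

  -- An inhabitant of `Fin m` certifies a positive exponent; the zeroth power of 0 would be 1.
  0^ : ∀ {m} → Fin m → 0# ^ m ≡ 0#
  0^ {suc m} _ = zeroˡ _

  -- Multiplication by x ≢ 0 permutes the field; g replaces 0 by 1 in the
  -- product of all elements and d corrects for it.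
  x^N≡x : ∀ x → x ^ N ≡ x
  x^N≡x x with x ≟ 0#
  ... | yes refl = 0^ (enumeration.to 0#)
  ... | no x≢0 with x′ , xx′ ← inverse x≢0 = sym (*-cancelˡ Πg≢0 (begin
      Π g * x                                ≡⟨ cong₂ _*_ Πg≡ (sym Πd≡) ⟩
      Π (g ∘ (x *_)) * Π d                   ≡⟨ sym (∑-distrib-+ {N} _ _) ⟩
      Π (λ a → g (x * a) * d a)              ≡⟨ sum-cong-≗ (λ i → gd (enumeration.from i)) ⟩
      Π (λ a → g a * x)                      ≡⟨ ∑-distrib-+ {N} _ _ ⟩
      Π g * Π (λ _ → x)                      ≡⟨ cong (Π g *_) (sum-replicate N) ⟩
      Π g * x ^ N                            ∎))
    where
    open Sum *-commutativeMonoid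
    Π : (Carrier → Carrier) → Carrier
    Π h = sum (h ∘ enumeration.from)
    g d : Carrier → Carrier
    g a with a ≟ 0#
    ... | yes _ = 1#
    ... | no  _ = a
    d a with a ≟ 0#
    ... | yes _ = x
    ... | no  _ = 1#
    g≢0 : ∀ a → g a ≢ 0#
    g≢0 a with a ≟ 0#
    ... | yes _   = 0≢1 ∘ sym
    ... | no a≢0  = a≢0
    Πg≢0 : Π g ≢ 0#
    Πg≢0 = product-≢0 _ (λ i → g≢0 (enumeration.from i))
    cancel : ∀ {y z} w → y * z ≡ 1# → y * (z * w) ≡ w
    cancel {y} {z} w p = trans (sym (*-assoc y z w)) (trans (cong (_* w) p) (*-identityˡ w))
    Πg≡ : Π g ≡ Π (g ∘ (x *_))
    Πg≡ = sum-reindex *-commutativeMonoid g (x *_) (x′ *_)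
      (λ w → cancel w xx′) (λ w → cancel w (trans (*-comm x′ x) xx′))
    gd : ∀ a → g (x * a) * d a ≡ g a * x
    gd a with a ≟ 0#
    gd a | yes refl with x * 0# ≟ 0#
    ... | yes _ = refl
    ... | no ne = contradiction (zeroʳ x) ne
    gd a | no a≢0 with x * a ≟ 0#
    ... | yes eq = contradiction eq (*-≢0 x≢0 a≢0)
    ... | no _   = trans (*-identityʳ _) (*-comm x a)
    d0 : ∀ a → a ≡ 0# → d a ≡ x
    d0 a a≡0 with a ≟ 0#
    ... | yes _ = refl
    ... | no ne = contradiction a≡0 ne
    d1 : ∀ a → a ≢ 0# → d a ≡ 1#
    d1 a a≢0 with a ≟ 0#
    ... | yes eq = contradiction eq a≢0
    ... | no _   = refl
    Πd≡ : Π d ≡ x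
    Πd≡ = trans (sum-at *-commutativeMonoid (enumeration.to 0#) (d ∘ enumeration.from)
        (λ j j≢ → d1 _ λ eq → j≢ (trans (sym (enumeration.strictlyInverseˡ j)) (cong enumeration.to eq))))
      (d0 _ (enumeration.strictlyInverseʳ 0#))

-- The exponent (3 ^ k + 1) / 2 modulo 4

odd-form : ∀ k → ¬ 2 ℕ.∣ k → ∃[ j ] k ≡ 1 ℕ.+ 2 ℕ.* j
odd-form zero          odd = contradiction (ℕ.divides 0 refl) odd
odd-form (suc zero)    odd = 0 , refl
odd-form (suc (suc k)) odd with j , refl ← odd-form k (odd ∘ ℕ.∣m∣n⇒∣m+n (ℕ.divides 1 refl)) =
  suc j , cong (2 ℕ.+_) (sym (ℕ.+-suc j (j ℕ.+ 0)))

-- Odd powers of 3 are 3 modulo 8, because 9 is 1 modulo 8. The induction step is 9t + 1 = 9(t + 1)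
-- - 8; the 8 is added to both sides to avoid truncated subtraction.
3^odd+1 : ∀ j → ∃[ c ] 3 ℕ.^ (1 ℕ.+ 2 ℕ.* j) ℕ.+ 1 ≡ (2 ℕ.+ 4 ℕ.* c) ℕ.* 2
3^odd+1 zero    = 0 , refl
3^odd+1 (suc j) with c , eq ← 3^odd+1 j = 3 ℕ.+ 9 ℕ.* c , ℕ.+-cancelʳ-≡ 8 _ _ (begin
  3 ℕ.^ (1 ℕ.+ 2 ℕ.* suc j) ℕ.+ 1 ℕ.+ 8
    ≡⟨ cong (λ m → 3 ℕ.^ m ℕ.+ 1 ℕ.+ 8) (cong suc (ℕ.*-suc 2 j)) ⟩
  3 ℕ.* (3 ℕ.* 3 ℕ.^ (1 ℕ.+ 2 ℕ.* j)) ℕ.+ 1 ℕ.+ 8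
    ≡⟨ solve 1 (λ t → con 3 :* (con 3 :* t) :+ con 1 :+ con 8 := con 9 :* (t :+ con 1))
         refl (3 ℕ.^ (1 ℕ.+ 2 ℕ.* j)) ⟩
  9 ℕ.* (3 ℕ.^ (1 ℕ.+ 2 ℕ.* j) ℕ.+ 1)
    ≡⟨ cong (9 ℕ.*_) eq ⟩
  9 ℕ.* ((2 ℕ.+ 4 ℕ.* c) ℕ.* 2)
    ≡⟨ solve 1 (λ c → con 9 :* ((con 2 :+ con 4 :* c) :* con 2)
                  := (con 2 :+ con 4 :* (con 3 :+ con 9 :* c)) :* con 2 :+ con 8) refl c ⟩
  (2 ℕ.+ 4 ℕ.* (3 ℕ.+ 9 ℕ.* c)) ℕ.* 2 ℕ.+ 8 ∎)
  where open ℕ.+-*-Solver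

module _ where
  open ℕ.+-*-Solver

  2+4* : ∀ c → 2 ℕ.+ 4 ℕ.* c ≡ 2 ℕ.* (1 ℕ.+ 2 ℕ.* c)
  2+4* = solve 1 (λ c → con 2 :+ con 4 :* c := con 2 :* (con 1 :+ con 2 :* c)) refl

  4+8* : ∀ c → 4 ℕ.+ 8 ℕ.* c ≡ (2 ℕ.+ 4 ℕ.* c) ℕ.* 2
  4+8* = solve 1 (λ c → con 4 :+ con 8 :* c := (con 2 :+ con 4 :* c) :* con 2) refl

  double-1+* : ∀ y m → (1 ℕ.+ y ℕ.* m) ℕ.+ (1 ℕ.+ y ℕ.* m) ≡ 2 ℕ.+ y ℕ.* (m ℕ.+ m)
  double-1+* = solve 2 (λ y m → (con 1 :+ y :* m) :+ (con 1 :+ y :* m) := con 2 :+ y :* (m :+ m)) refl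

-- Fields of characteristic 3 and Frobenius powers

module Characteristic3 {m : ℕ} (F : FiniteField (3 ℕ.^ m)) where

  open FiniteFieldProperties F public
  open Mult semiring using () renaming (_×_ to _·_; ×1-homo-* to ·1-homo-*)

  -- A field has no zero divisors: were 3 · 1 nonzero, its power 3 ^ m · 1 would be nonzero too,
  -- against `N·1≡0`.
  3·1≡0 : 3 · 1# ≡ 0#
  3·1≡0 with 3 · 1# ≟ 0#
  ... | yes eq = eq
  ... | no ne  = contradiction N·1≡0 (power≢0 m)
    where
    power≢0 : ∀ m → (3 ℕ.^ m) · 1# ≢ 0#
    power≢0 zero    eq = 0≢1 (trans (sym eq) (+-identityʳ 1#))
    power≢0 (suc m) eq = *-≢0 ne (power≢0 m) (trans (sym (·1-homo-* 3 (3 ℕ.^ m))) eq)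

  1+1≡-1 : 1# + 1# ≡ - 1#
  1+1≡-1 = +-cancelˡ 1# (trans (trans
    (cong (λ z → 1# + (1# + z)) (sym (+-identityʳ 1#))) 3·1≡0) (sym (-‿inverseʳ 1#)))

  -- Ring normalisation with coefficients in ℤ/3, written as Fin 3.
  module Solver where

    ring₃ : RawRing 0ℓ 0ℓ
    ring₃ = record
      { Carrier = Fin 3 ; _≈_ = _≡_ ; _+_ = _⊕_ ; _*_ = _⊛_ ; -_ = ⊝_ ; 0# = 0F ; 1# = 1F }
      where
      _⊕_ _⊛_ : Fin 3 → Fin 3 → Fin 3
      0F ⊕ b  = b
      1F ⊕ 0F = 1F
      1F ⊕ 1F = 2F
      1F ⊕ 2F = 0F
      2F ⊕ 0F = 2F
      2F ⊕ 1F = 0F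
      2F ⊕ 2F = 1F
      ⊝_ : Fin 3 → Fin 3
      ⊝ 0F = 0F
      ⊝ 1F = 2F
      ⊝ 2F = 1F
      0F ⊛ b = 0F
      1F ⊛ b = b
      2F ⊛ b = ⊝ b

    open RawRing ring₃ using () renaming (_+_ to _⊕_; _*_ to _⊛_; -_ to ⊝_)

    ⟦_⟧₃ : Fin 3 → Carrier
    ⟦ 0F ⟧₃ = 0#
    ⟦ 1F ⟧₃ = 1#
    ⟦ 2F ⟧₃ = - 1#

    +-homo : ∀ a b → ⟦ a ⊕ b ⟧₃ ≡ ⟦ a ⟧₃ + ⟦ b ⟧₃
    +-homo 0F b  = sym (+-identityˡ _)
    +-homo 1F 0F = sym (+-identityʳ _)
    +-homo 1F 1F = sym 1+1≡-1
    +-homo 1F 2F = sym (-‿inverseʳ 1#)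
    +-homo 2F 0F = sym (+-identityʳ _)
    +-homo 2F 1F = sym (-‿inverseˡ 1#)
    +-homo 2F 2F = sym (trans (-‿+-comm 1# 1#) (trans (cong -_ 1+1≡-1) (-‿involutive 1#)))

    -‿homo : ∀ a → ⟦ ⊝ a ⟧₃ ≡ - ⟦ a ⟧₃
    -‿homo 0F = sym -0#≈0#
    -‿homo 1F = refl
    -‿homo 2F = sym (-‿involutive 1#)

    *-homo : ∀ a b → ⟦ a ⊛ b ⟧₃ ≡ ⟦ a ⟧₃ * ⟦ b ⟧₃
    *-homo 0F b = sym (zeroˡ _)
    *-homo 1F b = sym (*-identityˡ _)
    *-homo 2F b = trans (-‿homo b) (trans (cong -_ (sym (*-identityˡ _))) (-‿distribˡ-* 1# ⟦ b ⟧₃))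

    morphism : ring₃ -Raw-AlmostCommutative⟶ fromCommutativeRing commutativeRing
    morphism = record
      { ⟦_⟧ = ⟦_⟧₃ ; +-homo = +-homo ; *-homo = *-homo ; -‿homo = -‿homo ; 0-homo = refl ; 1-homo = refl }

    weaklyDecide : ∀ a b → Maybe (⟦ a ⟧₃ ≡ ⟦ b ⟧₃)
    weaklyDecide 0F 0F = just refl
    weaklyDecide 1F 1F = just refl
    weaklyDecide 2F 2F = just refl
    weaklyDecide _  _  = nothing

    open RingSolver ring₃ (fromCommutativeRing commutativeRing) morphism weaklyDecide public

    :0 :1 : ∀ {i} → Polynomial i
    :0 = con 0F
    :1 = con 1F

  open Solver using (solve; _:+_; _:*_; :-_; _:-_; _:^_; _:=_; :0; :1)

  -≡0⇒≡ : ∀ {x y} → x - y ≡ 0# → x ≡ y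
  -≡0⇒≡ {x} {y} eq = trans (solve 2 (λ x y → x := x :- y :+ y) refl x y)
    (trans (cong (_+ y) eq) (+-identityˡ y))

  *≡0 : ∀ {x y} → x * y ≡ 0# → x ≡ 0# ⊎ y ≡ 0#
  *≡0 {x} {y} eq with x ≟ 0# | y ≟ 0#
  ... | yes p | _     = inj₁ p
  ... | no _  | yes q = inj₂ q
  ... | no p  | no q  = contradiction eq (*-≢0 p q)

  ≡-⇒≡0 : ∀ {x} → x ≡ - x → x ≡ 0#
  ≡-⇒≡0 {x} eq = trans (solve 1 (λ x → x := :- x :- x) refl x)
    (trans (cong (_- x) (sym eq)) (-‿inverseʳ x))

  square≡1 : ∀ {x} → x * x ≡ 1# → x ≡ 1# ⊎ x ≡ - 1#
  square≡1 {x} eq with *≡0 {x - 1#} {x + 1#} (trans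
      (solve 1 (λ x → (x :- :1) :* (x :+ :1) := x :* x :- :1) refl x)
      (trans (cong (_- 1#) eq) (-‿inverseʳ 1#)))
  ... | inj₁ p = inj₁ (-≡0⇒≡ p)
  ... | inj₂ p = inj₂ (-≡0⇒≡ (trans (cong (x +_) (-‿involutive 1#)) p))

  1^ : ∀ i → 1# ^ i ≡ 1#
  1^ zero    = refl
  1^ (suc i) = trans (*-identityˡ _) (1^ i)

  ^≡0⇒≡0 : ∀ {x} i → x ^ i ≡ 0# → x ≡ 0#
  ^≡0⇒≡0 zero    eq = contradiction (sym eq) 0≢1
  ^≡0⇒≡0 (suc i) eq = [ id , ^≡0⇒≡0 i ]′ (*≡0 eq)

  -- The solver has coefficients in ℤ/3, so the mixed terms of the cube vanish by normalisation;
  -- iteration does the rest.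
  frobenius-+ : ∀ i x y → (x + y) ^ (3 ℕ.^ i) ≡ x ^ (3 ℕ.^ i) + y ^ (3 ℕ.^ i)
  frobenius-+ zero    x y = solve 2 (λ x y → (x :+ y) :^ 1 := x :^ 1 :+ y :^ 1) refl x y
  frobenius-+ (suc i) x y = begin
    (x + y) ^ (3 ℕ.* 3 ℕ.^ i)                ≡⟨ sym (^-assocʳ (x + y) 3 (3 ℕ.^ i)) ⟩
    ((x + y) ^ 3) ^ (3 ℕ.^ i)
      ≡⟨ cong (_^ (3 ℕ.^ i)) (solve 2 (λ x y → (x :+ y) :^ 3 := x :^ 3 :+ y :^ 3) refl x y) ⟩
    (x ^ 3 + y ^ 3) ^ (3 ℕ.^ i)              ≡⟨ frobenius-+ i _ _ ⟩
    (x ^ 3) ^ (3 ℕ.^ i) + (y ^ 3) ^ (3 ℕ.^ i)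
      ≡⟨ cong₂ _+_ (^-assocʳ x 3 (3 ℕ.^ i)) (^-assocʳ y 3 (3 ℕ.^ i)) ⟩
    x ^ (3 ℕ.* 3 ℕ.^ i) + y ^ (3 ℕ.* 3 ℕ.^ i) ∎

  private
    Fixed : Carrier → ℕ → Set
    Fixed z i = z ^ (3 ℕ.^ i) ≡ z

    ^3^+ : ∀ z i j → z ^ (3 ℕ.^ (i ℕ.+ j)) ≡ (z ^ (3 ℕ.^ i)) ^ (3 ℕ.^ j)
    ^3^+ z i j = trans (^-congʳ z (ℕ.^-distribˡ-+-* 3 i j)) (sym (^-assocʳ z (3 ℕ.^ i) (3 ℕ.^ j)))

    Fixed-+ : ∀ {z} i j → Fixed z i → Fixed z j → Fixed z (i ℕ.+ j)
    Fixed-+ {z} i j p q = trans (^3^+ z i j) (trans (cong (_^ (3 ℕ.^ j)) p) q)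

    Fixed-* : ∀ {z} a i → Fixed z i → Fixed z (a ℕ.* i)
    Fixed-* {z} zero    i p = *-identityʳ z
    Fixed-* (suc a) i p = Fixed-+ i (a ℕ.* i) p (Fixed-* a i p)

    -- With `Fixed-+`, the exponents `i` for which the 3 ^ i-th power fixes `z` are closed under
    -- sums and differences. Divisibility among the numbers 3 ^ i - 1 thus becomes Bézout arithmetic
    -- on `i`.
    Fixed-cancel : ∀ {z} i j → Fixed z i → Fixed z (j ℕ.+ i) → Fixed z j
    Fixed-cancel {z} i j p r = trans (sym (trans (trans
      (^-congʳ z (cong (3 ℕ.^_) (ℕ.+-comm j i))) (^3^+ z i j)) (cong (_^ (3 ℕ.^ j)) p))) r

  -- The interface between the arithmetic of the exponent and the geometry. Through `f-^` the
  -- function commutes with conjugation, which makes the polarity symmetric; `f-square` keeps its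
  -- nonzero values off 𝔽 q · θ.
  record TwoToOne (f : Carrier → Carrier) : Set where
    field
      f0≡0         : f 0# ≡ 0#
      f-even       : ∀ x → f (- x) ≡ f x
      f-injective± : ∀ {x y} → f x ≡ f y → x ≡ y ⊎ x ≡ - y
      f-square     : ∀ x → ∃[ s ] f x ≡ s * s
      f-^          : ∀ x i → f (x ^ i) ≡ f x ^ i

    f≡0⇒≡0 : ∀ {x} → f x ≡ 0# → x ≡ 0#
    f≡0⇒≡0 fx≡0 = [ id , (λ x≡-0 → trans x≡-0 -0#≈0#) ]′ (f-injective± (trans fx≡0 (sym f0≡0)))

  -- The Coulter-Matthews function is two-to-one

  module CoulterMatthews (k : ℕ) (coprime : GCD.gcd k m ≡ 1) (2∣m : 2 ℕ.∣ m) where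

    private
      d : ℕ
      d = (3 ℕ.^ k ℕ.+ 1) ℕ./ 2

      exponent : ∃[ c ] 3 ℕ.^ k ℕ.+ 1 ≡ (2 ℕ.+ 4 ℕ.* c) ℕ.* 2
      -- An even `k` would share the factor 2 with `m`.
      exponent with odd-form k (λ 2∣k → 2∤1 (subst (2 ℕ.∣_) coprime (GCD.gcd-greatest 2∣k 2∣m)))
        where
        2∤1 : ¬ 2 ℕ.∣ 1
        2∤1 = ℕ.>⇒∤ (ℕ.s≤s (ℕ.s≤s ℕ.z≤n))
      ... | j , refl = 3^odd+1 j

      c : ℕ
      c = proj₁ exponent

      d≡ : d ≡ 2 ℕ.+ 4 ℕ.* c
      d≡ = trans (cong (ℕ._/ 2) (proj₂ exponent)) (ℕ.m*n/n≡m (2 ℕ.+ 4 ℕ.* c) 2)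

      2d≡ : d ℕ.* 2 ≡ 3 ℕ.^ k ℕ.+ 1
      2d≡ = trans (cong (ℕ._* 2) d≡) (sym (proj₂ exponent))

    f : Carrier → Carrier
    f = coulterMatthews F k

    d-even : ∃[ e ] d ≡ 2 ℕ.* e
    d-even = 1 ℕ.+ 2 ℕ.* c , trans d≡ (2+4* c)

    f-square : ∀ x → ∃[ s ] f x ≡ s * s
    f-square x = x ^ e , trans (^-congʳ x (trans eq (cong (e ℕ.+_) (ℕ.+-identityʳ e)))) (^-homo-* x e e)
      where
      e = proj₁ d-even
      eq = proj₂ d-even

    f-^ : ∀ x i → f (x ^ i) ≡ f x ^ i
    f-^ x i = trans (^-assocʳ x i d) (trans (^-congʳ x (ℕ.*-comm i d)) (sym (^-assocʳ x d i)))

    f-even : ∀ x → f (- x) ≡ f x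
    f-even x = begin
      (- x) ^ d               ≡⟨ ^-congʳ (- x) eq ⟩
      (- x) ^ (2 ℕ.* e)       ≡⟨ sym (^-assocʳ (- x) 2 e) ⟩
      ((- x) ^ 2) ^ e         ≡⟨ cong (_^ e) (solve 1 (λ x → (:- x) :^ 2 := x :^ 2) refl x) ⟩
      (x ^ 2) ^ e             ≡⟨ ^-assocʳ x 2 e ⟩
      x ^ (2 ℕ.* e)           ≡⟨ sym (^-congʳ x eq) ⟩
      x ^ d                   ∎
      where
      e = proj₁ d-even
      eq = proj₂ d-even

    f0≡0 : f 0# ≡ 0#
    f0≡0 = trans (^-congʳ 0# d≡) (zeroˡ _)

    -- The order of z divides 3^(2k) − 1 and 3^m − 1, hence 3² − 1, while
    -- d ≡ 2 (mod 4).
    f≡1⇒square≡1 : ∀ {z} → f z ≡ 1# → z * z ≡ 1#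
    f≡1⇒square≡1 {z} fz≡1 = trans (sym (*-identityʳ _)) (begin
      z * z * 1#                  ≡⟨ cong (z * z *_) (sym (trans (cong (_^ c) z⁴≡1) (1^ c))) ⟩
      z * z * (z ^ 4) ^ c         ≡⟨ cong (z * z *_) (^-assocʳ z 4 c) ⟩
      z * z * z ^ (4 ℕ.* c)       ≡⟨ *-assoc z z _ ⟩
      z ^ (2 ℕ.+ 4 ℕ.* c)         ≡⟨ sym (^-congʳ z d≡) ⟩
      z ^ d                       ≡⟨ fz≡1 ⟩
      1#                          ∎)
      where
      z≢0 : z ≢ 0#
      z≢0 refl = 0≢1 (trans (sym f0≡0) fz≡1)
      z^3^k*z : z ^ (3 ℕ.^ k) * z ≡ 1#
      z^3^k*z = begin
        z ^ (3 ℕ.^ k) * z        ≡⟨ cong (z ^ (3 ℕ.^ k) *_) (sym (*-identityʳ z)) ⟩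
        z ^ (3 ℕ.^ k) * z ^ 1    ≡⟨ sym (^-homo-* z (3 ℕ.^ k) 1) ⟩
        z ^ (3 ℕ.^ k ℕ.+ 1)      ≡⟨ ^-congʳ z (sym 2d≡) ⟩
        z ^ (d ℕ.* 2)            ≡⟨ sym (^-assocʳ z d 2) ⟩
        (z ^ d) ^ 2              ≡⟨ cong (_^ 2) fz≡1 ⟩
        1# ^ 2                   ≡⟨ 1^ 2 ⟩
        1#                       ∎
      -- The 3 ^ k-th power inverts `z`, so applying it twice is the identity on `z`.
      fixed-2k : Fixed z (k ℕ.+ k)
      fixed-2k = *-cancelˡ (z≢0 ∘ ^≡0⇒≡0 (3 ℕ.^ k)) (begin
        w * z ^ (3 ℕ.^ (k ℕ.+ k)) ≡⟨ cong (w *_) (^3^+ z k k) ⟩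
        w * w ^ (3 ℕ.^ k)         ≡⟨ *-comm _ _ ⟩
        w ^ (3 ℕ.^ k) * w         ≡⟨ sym (^-distrib-* w z (3 ℕ.^ k)) ⟩
        (w * z) ^ (3 ℕ.^ k)       ≡⟨ cong (_^ (3 ℕ.^ k)) z^3^k*z ⟩
        1# ^ (3 ℕ.^ k)            ≡⟨ 1^ (3 ℕ.^ k) ⟩
        1#                        ≡⟨ sym z^3^k*z ⟩
        w * z                     ∎)
        where
        w = z ^ (3 ℕ.^ k)
      fixed-m : Fixed z m
      fixed-m = x^N≡x z
      -- Only k + k, not `k`, is known to fix `z`, so Bézout's identity is doubled: 1 + ym = xk
      -- becomes 2 + y(m + m) = x(k + k), and cancelling leaves the exponent 2.
      fixed-2 : Fixed z 2
      fixed-2 with GCD.Bézout.identity (subst (GCD.GCD k m) coprime (GCD.gcd-GCD k m))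
      ... | GCD.Bézout.+- x y eq = Fixed-cancel (y ℕ.* (m ℕ.+ m)) 2
            (Fixed-* y (m ℕ.+ m) (Fixed-+ m m fixed-m fixed-m))
            (subst (Fixed z) (trans (ℕ.*-distribˡ-+ x k k)
              (trans (cong₂ ℕ._+_ (sym eq) (sym eq)) (double-1+* y m)))
              (Fixed-* x (k ℕ.+ k) fixed-2k))
      ... | GCD.Bézout.-+ x y eq = Fixed-cancel (x ℕ.* (k ℕ.+ k)) 2
            (Fixed-* x (k ℕ.+ k) fixed-2k)
            (subst (Fixed z) (trans (ℕ.*-distribˡ-+ y m m)
              (trans (cong₂ ℕ._+_ (sym eq) (sym eq)) (double-1+* x k)))
              (Fixed-* y (m ℕ.+ m) (Fixed-+ m m fixed-m fixed-m)))
      z⁸≡1 : z ^ 8 ≡ 1#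
      z⁸≡1 = *-cancelˡ z≢0 (trans fixed-2 (sym (*-identityʳ z)))
      z⁴≡1 : z ^ 4 ≡ 1#
      z⁴≡1 = begin
        z ^ 4                        ≡⟨ sym (*-identityʳ _) ⟩
        z ^ 4 * 1#                   ≡⟨ cong (z ^ 4 *_) (sym (trans (cong (_^ c) z⁸≡1) (1^ c))) ⟩
        z ^ 4 * (z ^ 8) ^ c          ≡⟨ cong (z ^ 4 *_) (^-assocʳ z 8 c) ⟩
        z ^ 4 * z ^ (8 ℕ.* c)        ≡⟨ sym (^-homo-* z 4 (8 ℕ.* c)) ⟩
        z ^ (4 ℕ.+ 8 ℕ.* c)          ≡⟨ ^-congʳ z (4+8* c) ⟩
        z ^ ((2 ℕ.+ 4 ℕ.* c) ℕ.* 2)  ≡⟨ ^-congʳ z (cong (ℕ._* 2) (sym d≡)) ⟩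
        z ^ (d ℕ.* 2)                ≡⟨ sym (^-assocʳ z d 2) ⟩
        (z ^ d) ^ 2                  ≡⟨ cong (_^ 2) fz≡1 ⟩
        1# ^ 2                       ≡⟨ 1^ 2 ⟩
        1#                           ∎

    -- A power map is multiplicative, so for y ≢ 0 the quotient x / y is sent to 1; its square is
    -- then 1.
    f-injective± : ∀ {x y} → f x ≡ f y → x ≡ y ⊎ x ≡ - y
    f-injective± {x} {y} eq with y ≟ 0#
    ... | yes refl = inj₁ (^≡0⇒≡0 d (trans eq f0≡0))
    ... | no y≢0 with y′ , yy′ ← inverse y≢0 =
      [ (λ p → inj₁ (trans x≡ (trans (cong (_* y) p) (*-identityˡ y))))
      , (λ p → inj₂ (trans x≡ (trans (cong (_* y) p) (solve 1 (λ y → :- :1 :* y := :- y) refl y)))) ]′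
      (square≡1 (f≡1⇒square≡1 fz≡1))
      where
      x≡ : x ≡ x * y′ * y
      x≡ = sym (trans (*-assoc x y′ y) (trans (cong (x *_) (trans (*-comm y′ y) yy′)) (*-identityʳ x)))
      fz≡1 : f (x * y′) ≡ 1#
      fz≡1 = begin
        (x * y′) ^ d     ≡⟨ ^-distrib-* x y′ d ⟩
        x ^ d * y′ ^ d   ≡⟨ cong (_* y′ ^ d) eq ⟩
        y ^ d * y′ ^ d   ≡⟨ sym (^-distrib-* y y′ d) ⟩
        (y * y′) ^ d     ≡⟨ cong (_^ d) yy′ ⟩
        1# ^ d           ≡⟨ 1^ d ⟩
        1#               ∎

    twoToOne : TwoToOne f
    twoToOne = record
      { f0≡0 = f0≡0 ; f-even = f-even ; f-injective± = f-injective± ; f-square = f-square ; f-^ = f-^ }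

-- Pigeonholes with a sign

compare₂ : ∀ {m} → Fin m → Fin m → Fin 2
compare₂ i j with i Fin.<? j
... | yes _ = 0F
... | no  _ = 1F

-- For distinct indices exactly one order of the arguments gives `0F`, so the value distinguishes a
-- pair from its reversal.
compare₂-symmetric : ∀ {m} (i j : Fin m) → compare₂ i j ≡ compare₂ j i → i ≡ j
compare₂-symmetric i j eq with i Fin.<? j | j Fin.<? i
... | yes p | yes r = contradiction p (Fin.<-asym r)
compare₂-symmetric i j () | yes _ | no _
compare₂-symmetric i j () | no _ | yes _
... | no p  | no r with Fin.<-cmp i j
...   | tri< p′ _ _ = contradiction p′ p
...   | tri≈ _ s _  = s
...   | tri> _ _ r′ = contradiction r′ r

pigeonhole₂ : ∀ {m k N} → m ℕ.* k ℕ.< N → (g : Fin N → Fin m) (h : Fin N → Fin k) →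
              ∃₂ λ i j → i Fin.< j × g i ≡ g j × h i ≡ h j
pigeonhole₂ mk<N g h with i , j , i<j , eq ← Fin.pigeonhole mk<N (λ i → combine (g i) (h i)) =
  i , j , i<j , Fin.combine-injective (g i) (h i) (g j) (h j) eq

-- Conjugation over the subfield of order `q`: trace, norm, cosets

module Conjugation (n : ℕ) (F : FiniteField (3 ℕ.^ (2 ℕ.* n))) where

  open Characteristic3 {2 ℕ.* n} F public
  open Solver using (solve; _:+_; _:*_; :-_; _:-_; _:=_; :0; :1)

  q : ℕ
  q = 3 ℕ.^ n

  q*q≡ : q ℕ.* q ≡ 3 ℕ.^ (2 ℕ.* n)
  q*q≡ = trans (sym (ℕ.^-distribˡ-+-* 3 n n)) (cong (λ i → 3 ℕ.^ (n ℕ.+ i)) (sym (ℕ.+-identityʳ n)))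

  conj : Carrier → Carrier
  conj x = x ^ q

  conj-+ : ∀ x y → conj (x + y) ≡ conj x + conj y
  conj-+ = frobenius-+ n

  conj-* : ∀ x y → conj (x * y) ≡ conj x * conj y
  conj-* x y = ^-distrib-* x y q

  conj-involutive : ∀ x → conj (conj x) ≡ x
  conj-involutive x = trans (^-assocʳ x q q) (trans (^-congʳ x q*q≡) (x^N≡x x))

  conj-0 : conj 0# ≡ 0#
  conj-0 = +-cancelˡ (conj 0#) (trans (sym (conj-+ 0# 0#))
    (trans (cong conj (+-identityʳ 0#)) (sym (+-identityʳ _))))

  conj-neg : ∀ x → conj (- x) ≡ - conj x
  conj-neg x = +-cancelˡ (conj x) (trans (sym (conj-+ x (- x)))
    (trans (cong conj (-‿inverseʳ x)) (trans conj-0 (sym (-‿inverseʳ (conj x))))))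

  conj-sub : ∀ x y → conj (x - y) ≡ conj x - conj y
  conj-sub x y = trans (conj-+ x (- y)) (cong (conj x +_) (conj-neg y))

  TraceZero : Pred Carrier 0ℓ
  TraceZero v = v + conj v ≡ 0#

  trace∈𝔽 : ∀ x → x + conj x ∈ 𝔽 q
  trace∈𝔽 x = trans (conj-+ x (conj x)) (trans (cong (conj x +_) (conj-involutive x)) (+-comm _ _))

  norm∈𝔽 : ∀ x → x * conj x ∈ 𝔽 q
  norm∈𝔽 x = trans (conj-* x (conj x)) (trans (cong (conj x *_) (conj-involutive x)) (*-comm _ _))

  difference∈TraceZero : ∀ x → x - conj x ∈ TraceZero
  difference∈TraceZero x = trans
    (cong (x - conj x +_) (trans (conj-sub x (conj x)) (cong (λ w → conj x - w) (conj-involutive x))))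
    (solve 2 (λ x y → (x :- y) :+ (y :- x) := :0) refl x (conj x))

  TraceZero⇒conj≡- : ∀ {v} → v ∈ TraceZero → conj v ≡ - v
  TraceZero⇒conj≡- {v} p = +-cancelˡ v (trans p (sym (-‿inverseʳ v)))

  TraceZero-neg : ∀ {v} → v ∈ TraceZero → - v ∈ TraceZero
  TraceZero-neg {v} p = trans (cong (- v +_) (conj-neg v))
    (trans (-‿+-comm v (conj v)) (trans (cong -_ p) -0#≈0#))

  𝔽-* : ∀ {x y} → x ∈ 𝔽 q → y ∈ 𝔽 q → x * y ∈ 𝔽 q
  𝔽-* p r = trans (conj-* _ _) (cong₂ _*_ p r)

  𝔽-+ : ∀ {x y} → x ∈ 𝔽 q → y ∈ 𝔽 q → x + y ∈ 𝔽 q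
  𝔽-+ p r = trans (conj-+ _ _) (cong₂ _+_ p r)

  𝔽-neg : ∀ {x} → x ∈ 𝔽 q → - x ∈ 𝔽 q
  𝔽-neg p = trans (conj-neg _) (cong -_ p)

  conj-1 : conj 1# ≡ 1#
  conj-1 = 1^ q

  𝔽-inverse : ∀ {x y} → x ≢ 0# → x * y ≡ 1# → x ∈ 𝔽 q → y ∈ 𝔽 q
  𝔽-inverse {x} {y} x≢0 xy≡1 p = *-cancelˡ x≢0 (trans (cong (_* conj y) (sym p))
    (trans (sym (conj-* x y)) (trans (cong conj xy≡1) (trans conj-1 (sym xy≡1)))))

  module Nonsquare (θ : Carrier) (θ≢0 : θ ≢ 0#) (nonsquare : ¬ SquareIn (𝔽 q) (θ ^ (q ℕ.+ 1))) where

    θ^[q+1] : θ ^ (q ℕ.+ 1) ≡ θ * conj θ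
    θ^[q+1] = trans (^-homo-* θ q 1) (trans (cong (conj θ *_) (*-identityʳ θ)) (*-comm (conj θ) θ))

    -- On the subfield the norm is squaring, so such a `θ` would have a square norm.
    θ∉𝔽 : θ ∉ 𝔽 q
    θ∉𝔽 θ∈𝔽 = nonsquare (θ , θ∈𝔽 , trans θ^[q+1] (cong (θ *_) θ∈𝔽))

    θ⁻¹ : Carrier
    θ⁻¹ = proj₁ (inverse θ≢0)

    θ*θ⁻¹ : ∀ x → x * θ⁻¹ * θ ≡ x
    θ*θ⁻¹ x = trans (*-assoc x θ⁻¹ θ)
      (trans (cong (x *_) (trans (*-comm θ⁻¹ θ) (proj₂ (inverse θ≢0)))) (*-identityʳ x))

    θ⁻¹*θ : ∀ x → x * θ * θ⁻¹ ≡ x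
    θ⁻¹*θ x = trans (*-assoc x θ θ⁻¹)
      (trans (cong (x *_) (proj₂ (inverse θ≢0))) (*-identityʳ x))

    -- A nonzero element of trace zero. Multiplication by it is a bijection from `𝔽 q` to
    -- `TraceZero`.
    δ : Carrier
    δ = θ - conj θ

    δ≢0 : δ ≢ 0#
    δ≢0 = θ∉𝔽 ∘ sym ∘ -≡0⇒≡

    δ⁻¹ : Carrier
    δ⁻¹ = proj₁ (inverse δ≢0)

    δ*δ⁻¹ : ∀ x → δ * (δ⁻¹ * x) ≡ x
    δ*δ⁻¹ x = trans (sym (*-assoc δ δ⁻¹ x))
      (trans (cong (_* x) (proj₂ (inverse δ≢0))) (*-identityˡ x))

    δ⁻¹*δ : ∀ x → δ⁻¹ * (δ * x) ≡ x
    δ⁻¹*δ x = *-cancelˡ δ≢0 (δ*δ⁻¹ (δ * x))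

    conj-δ : conj δ ≡ - δ
    conj-δ = TraceZero⇒conj≡- (difference∈TraceZero θ)

    conj-δ⁻¹ : conj δ⁻¹ ≡ - δ⁻¹
    conj-δ⁻¹ = *-cancelˡ δ≢0 (begin
      δ * conj δ⁻¹           ≡⟨ solve 2 (λ d i → d :* i := :- (:- d :* i)) refl δ (conj δ⁻¹) ⟩
      - (- δ * conj δ⁻¹)     ≡⟨ cong (λ z → - (z * conj δ⁻¹)) (sym conj-δ) ⟩
      - (conj δ * conj δ⁻¹)  ≡⟨ cong -_ (sym (conj-* δ δ⁻¹)) ⟩
      - conj (δ * δ⁻¹)       ≡⟨ cong -_ (trans (cong conj (proj₂ (inverse δ≢0))) conj-1) ⟩
      - 1#                   ≡⟨ cong -_ (sym (proj₂ (inverse δ≢0))) ⟩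
      - (δ * δ⁻¹)            ≡⟨ -‿distribʳ-* δ δ⁻¹ ⟩
      δ * - δ⁻¹              ∎)

    𝔽⇒TraceZero : ∀ {t} → t ∈ 𝔽 q → δ * t ∈ TraceZero
    𝔽⇒TraceZero {t} p = trans (cong (δ * t +_) (trans (conj-* δ t) (cong₂ _*_ conj-δ p)))
      (solve 2 (λ d t → d :* t :+ :- d :* t := :0) refl δ t)

    TraceZero⇒𝔽 : ∀ {v} → v ∈ TraceZero → δ⁻¹ * v ∈ 𝔽 q
    TraceZero⇒𝔽 {v} p = trans (conj-* δ⁻¹ v) (trans (cong₂ _*_ conj-δ⁻¹ (TraceZero⇒conj≡- p))
      (solve 2 (λ d v → :- d :* :- v := d :* v) refl δ⁻¹ v))

    -- In characteristic 3 one half is −1.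
    module _ {r w} (r∈𝔽 : r ∈ 𝔽 q) (w∈TraceZero : w ∈ TraceZero) where

      private
        z : Carrier
        z = - (r + w)

        conj-z : conj z ≡ - (r - w)
        conj-z = trans (conj-neg (r + w)) (cong -_
          (trans (conj-+ r w) (cong₂ _+_ r∈𝔽 (TraceZero⇒conj≡- w∈TraceZero))))

      trace-part : z + conj z ≡ r
      trace-part = trans (cong (z +_) conj-z)
        (solve 2 (λ r w → :- (r :+ w) :+ :- (r :- w) := r) refl r w)

      difference-part : z - conj z ≡ w
      difference-part = trans (cong (λ w → z - w) conj-z)
        (solve 2 (λ r w → :- (r :+ w) :- :- (r :- w) := w) refl r w)

    from-parts : ∀ z → - ((z + conj z) + (z - conj z)) ≡ z
    from-parts z = solve 2 (λ z y → :- ((z :+ y) :+ (z :- y)) := z) refl z (conj z)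

    private
      subfield : ∃ (Enumeration (𝔽 q))
      subfield = map₂ (Enumeration-transport (at elements) enumeration.to
          id (λ {y} p → subst (_∈ 𝔽 q) (sym (at-index elements {y} tt)) p)
          (λ {i} _ → index-at elements i tt) (λ {y} _ → at-index elements {y} tt))
        (enumerateDecidable (λ i → conj (at elements i) ≟ at elements i))

      -- `𝔽 q` is given by an equation, which does not tell how many roots it has. Every element is
      -- - (r + δ s) for unique r and s in `𝔽 q`, read off from its trace and its difference with
      -- the conjugate; hence the unknown size squares to q · q.
      subfield² : ∀ {j} → Enumeration (𝔽 q) j → Enumeration {Carrier} U (j ℕ.* j)
      subfield² e = Enumeration-transport
        (λ (r , s) → - (r + δ * s)) (λ z → z + conj z , δ⁻¹ * (z - conj z))
        (λ _ → tt) (λ {z} _ → trace∈𝔽 z , TraceZero⇒𝔽 (difference∈TraceZero z))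
        (λ {(r , s)} (r∈ , s∈) → cong₂ _,_ (trace-part r∈ (𝔽⇒TraceZero s∈))
          (trans (cong (δ⁻¹ *_) (difference-part r∈ (𝔽⇒TraceZero s∈))) (δ⁻¹*δ s)))
        (λ {z} _ → trans (cong (λ w → - (z + conj z + w)) (δ*δ⁻¹ _)) (from-parts z))
        (Enumeration-× e e)

      *-square-injective : ∀ {i j} → i ℕ.* i ≡ j ℕ.* j → i ≡ j
      *-square-injective {i} {j} eq with ℕ.<-cmp i j
      ... | tri≈ _ i≡j _ = i≡j
      ... | tri< i<j _ _ = contradiction eq (ℕ.<⇒≢ (ℕ.*-mono-< i<j i<j))
      ... | tri> _ _ j<i = contradiction (sym eq) (ℕ.<⇒≢ (ℕ.*-mono-< j<i j<i))

    enumerate-𝔽 : Enumeration (𝔽 q) q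
    enumerate-𝔽 = subst (Enumeration (𝔽 q))
      (*-square-injective (trans (Enumeration-unique (subfield² e) elements) (sym q*q≡))) e
      where
      e : Enumeration (𝔽 q) (proj₁ subfield)
      e = proj₂ subfield

    -- The same decomposition, with the trace scaled by `δ` into `TraceZero`, identifies pairs of
    -- trace-zero elements with the whole field.
    enumerate-TraceZero² : Enumeration (TraceZero ⟨×⟩ TraceZero) (3 ℕ.^ (2 ℕ.* n))
    enumerate-TraceZero² = Enumeration-transport
      (λ z → δ * (z + conj z) , z - conj z) (λ (u , v) → - (δ⁻¹ * u + v))
      (λ {z} _ → 𝔽⇒TraceZero (trace∈𝔽 z) , difference∈TraceZero z) (λ _ → tt)
      (λ {z} _ → trans (cong (λ w → - (w + (z - conj z))) (δ⁻¹*δ _)) (from-parts z))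
      (λ {(u , v)} (u∈ , v∈) → cong₂ _,_
        (trans (cong (δ *_) (trace-part (TraceZero⇒𝔽 u∈) v∈)) (δ*δ⁻¹ u))
        (difference-part (TraceZero⇒𝔽 u∈) v∈))
      elements

    -- By definition the condition that `𝒰[ θ ] q` puts on the second coordinate of an affine point;
    -- the first coordinate is free.
    𝔽θ : Pred Carrier 0ℓ
    𝔽θ y = ∃[ t ] t ∈ 𝔽 q × y ≡ t * θ

    enumerate-𝔽θ : Enumeration 𝔽θ q
    enumerate-𝔽θ = Enumeration-transport (_* θ) (_* θ⁻¹)
      (λ {t} p → t , p , refl) (λ { (t , p , refl) → subst (_∈ 𝔽 q) (sym (θ⁻¹*θ t)) p })
      (λ {t} _ → θ⁻¹*θ t) (λ {y} _ → θ*θ⁻¹ y) enumerate-𝔽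

    𝔽θ-+ : ∀ {x y} → x ∈ 𝔽θ → y ∈ 𝔽θ → x + y ∈ 𝔽θ
    𝔽θ-+ (s , s∈ , refl) (t , t∈ , refl) = s + t , 𝔽-+ s∈ t∈ , sym (distribʳ θ s t)

    𝔽θ-neg : ∀ {x} → x ∈ 𝔽θ → - x ∈ 𝔽θ
    𝔽θ-neg (t , t∈ , refl) = - t , 𝔽-neg t∈ , -‿distribˡ-* t θ

    0∈𝔽θ : 0# ∈ 𝔽θ
    0∈𝔽θ = 0# , conj-0 , sym (zeroˡ θ)

    -- The map z ↦ z - conj z is additive with kernel `𝔽 q`; precomposed with division by `θ` it
    -- separates the cosets of `𝔽θ`.
    coset : Carrier → Carrier
    coset y = y * θ⁻¹ - conj (y * θ⁻¹)

    coset-injective : ∀ {x y} → coset x ≡ coset y → x - y ∈ 𝔽θ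
    coset-injective {x} {y} eq = x * θ⁻¹ - y * θ⁻¹
      , trans (conj-sub _ _) (sym (-≡0⇒≡ (trans
          (solve 4 (λ x x′ y y′ → (x :- y) :- (x′ :- y′) := (x :- x′) :- (y :- y′)) refl
             (x * θ⁻¹) (conj (x * θ⁻¹)) (y * θ⁻¹) (conj (y * θ⁻¹)))
          (trans (cong (_- coset y) eq) (-‿inverseʳ _)))))
      , sym (trans (solve 4 (λ x y i t → (x :* i :- y :* i) :* t := x :* i :* t :- y :* i :* t)
            refl x y θ⁻¹ θ)
          (cong₂ _-_ (θ*θ⁻¹ x) (θ*θ⁻¹ y)))

    -- If s² = tθ with t ≢ 0 in `𝔽 q`, taking norms exhibits the norm of `θ` as the square of (s ·
    -- conj s) / t, an element of `𝔽 q`.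
    square∈𝔽θ⇒≡0 : ∀ {s} → s * s ∈ 𝔽θ → s * s ≡ 0#
    square∈𝔽θ⇒≡0 {s} (t , t∈𝔽 , s²≡tθ) with t ≟ 0#
    ... | yes refl = trans s²≡tθ (zeroˡ θ)
    ... | no t≢0 with t⁻¹ , tt⁻¹ ← inverse t≢0 = contradiction
        (r * t⁻¹ , 𝔽-* (norm∈𝔽 s) (𝔽-inverse t≢0 tt⁻¹ t∈𝔽) , trans θ^[q+1] (begin
          θ * conj θ
            ≡⟨ unit (unit refl) ⟩
          t * t⁻¹ * (t * t⁻¹ * (θ * conj θ))
            ≡⟨ solve 4 (λ t i a b → t :* i :* (t :* i :* (a :* b)) := (t :* a) :* (t :* b) :* (i :* i))
                refl t t⁻¹ θ (conj θ) ⟩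
          (t * θ) * (t * conj θ) * (t⁻¹ * t⁻¹)
            ≡⟨ cong (_* (t⁻¹ * t⁻¹)) (cong₂ _*_ (sym s²≡tθ) conj-s²) ⟩
          s * s * (conj s * conj s) * (t⁻¹ * t⁻¹)
            ≡⟨ solve 3 (λ s c i → s :* s :* (c :* c) :* (i :* i) := s :* c :* i :* (s :* c :* i))
                refl s (conj s) t⁻¹ ⟩
          r * t⁻¹ * (r * t⁻¹) ∎)) nonsquare
      where
      r : Carrier
      r = s * conj s
      conj-s² : t * conj θ ≡ conj s * conj s
      conj-s² = trans (cong (_* conj θ) (sym t∈𝔽))
        (trans (sym (conj-* t θ)) (trans (cong conj (sym s²≡tθ)) (conj-* s s)))
      unit : ∀ {x y} → x ≡ y → x ≡ t * t⁻¹ * y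
      unit p = trans p (sym (trans (cong (_* _) tt⁻¹) (*-identityˡ _)))

    -- Values of `f` congruent modulo 𝔽 q · θ

    module _ .{{_ : NonZero n}} {f : Carrier → Carrier} (twoToOne : TwoToOne f) where

      open TwoToOne twoToOne

      f∈𝔽θ⇒≡0 : ∀ {x} → f x ∈ 𝔽θ → x ≡ 0#
      f∈𝔽θ⇒≡0 {x} p with s , eq ← f-square x =
        f≡0⇒≡0 (trans eq (square∈𝔽θ⇒≡0 {s} (subst (_∈ 𝔽θ) eq p)))

      private
        sign : Carrier → Fin 2
        sign a = compare₂ (enumeration.to a) (enumeration.to (- a))

        sign≡⇒≡0 : ∀ a → sign a ≡ sign (- a) → a ≡ 0#
        sign≡⇒≡0 a eq = ≡-⇒≡0 (index-injective elements _ _ (compare₂-symmetric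
          (enumeration.to a) (enumeration.to (- a))
          (trans eq (cong (compare₂ (enumeration.to (- a)) ∘ enumeration.to) (-‿involutive a)))))

        coset-index : Carrier → Fin q
        coset-index a = index enumerate-𝔽 (TraceZero⇒𝔽 (difference∈TraceZero (f a * θ⁻¹)))

        coset-index≡ : ∀ {a b} → coset-index a ≡ coset-index b → f a - f b ∈ 𝔽θ
        coset-index≡ {a} {b} eq = coset-injective (trans (sym (δ*δ⁻¹ _))
          (trans (cong (δ *_) (index-injective enumerate-𝔽 _ _ eq)) (δ*δ⁻¹ _)))

        -- Positivity of `n` gives 3 ≤ q, which is 2 < q by unfolding.
        q*2<N : q ℕ.* 2 ℕ.< 3 ℕ.^ (2 ℕ.* n)
        q*2<N = subst (q ℕ.* 2 ℕ.<_) q*q≡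
          (ℕ.*-monoʳ-< q {{ℕ.m^n≢0 3 n}} (ℕ.^-monoʳ-≤ 3 (ℕ.>-nonZero⁻¹ n)))

        -- The sign keeps a and − a apart at the price of 2q pigeonholes, still fewer than q².
        Collision : Fin (3 ℕ.^ (2 ℕ.* n)) → Fin (3 ℕ.^ (2 ℕ.* n)) → Set
        Collision i j = i Fin.< j
          × coset-index (at elements i) ≡ coset-index (at elements j)
          × sign (at elements i) ≡ sign (at elements j)

        collision : ∃₂ Collision
        collision = pigeonhole₂ q*2<N (coset-index ∘ at elements) (sign ∘ at elements)

        separate : ∃₂ Collision → ∃₂ λ a b → a ≢ 0# × a ≢ b × a ≢ - b × f a - f b ∈ 𝔽θ
        separate (i , j , i<j , coset≡ , sign≡) = a , b , a≢0 , a≢b , a≢-b , fa-fb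
          where
          a b : Carrier
          a = at elements i
          b = at elements j
          fa-fb : f a - f b ∈ 𝔽θ
          fa-fb = coset-index≡ coset≡
          a≢b : a ≢ b
          a≢b = Fin.<⇒≢ i<j ∘ at-injective elements
          -- For a = 0 the congruence puts f b in `𝔽θ`, which forces b = 0 = a.
          a≢0 : a ≢ 0#
          a≢0 a≡0 = a≢b (trans a≡0 (sym (f∈𝔽θ⇒≡0 (subst (_∈ 𝔽θ)
            (trans (cong (λ z → - (z - f b)) (trans (cong f a≡0) f0≡0))
              (solve 1 (λ z → :- (:0 :- z) := z) refl (f b)))
            (𝔽θ-neg fa-fb)))))
          -- Equal signs of b and - b would force b = 0, and then a = 0.
          a≢-b : a ≢ - b
          a≢-b a≡-b = a≢0 (trans a≡-b (trans (cong -_ (sign≡⇒≡0 b (trans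
            (sym sign≡) (cong sign a≡-b)))) -0#≈0#))

      f-congruent : ∃₂ λ a b → a ≢ 0# × a ≢ b × a ≢ - b × f a - f b ∈ 𝔽θ
      f-congruent = separate collision

-- Shifts, collineations and tangents

module PlaneProperties {N : ℕ} (F : FiniteField N) (f : FiniteField.Carrier F → FiniteField.Carrier F) where

  open FiniteFieldProperties F
  open Plane F f
  private module C = Collineation

  module _ {S : Pred Point 0ℓ} where

    τ-fixing : ∀ {u v} → (∀ {P} → P ∈ S → shiftPoint u v P ∈ S) →
               (∀ {P} → P ∈ S → shiftPoint (- u) (- v) P ∈ S) → τ u v ∈ Fixing S
    τ-fixing {u} {v} p r = (λ { (P , P∈S , refl) → p P∈S })
      , λ {Q} Q∈S → shiftPoint (- u) (- v) Q , r Q∈S , Inverse.strictlyInverseˡ (C.bijection (τ u v)) Q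

    private
      Fixing-resp : ∀ {g h} → (∀ P → C.to g P ≡ C.to h P) → g ∈ Fixing S → h ∈ Fixing S
      Fixing-resp g≋h (p , r) = (λ { (P , P∈S , refl) → p (P , P∈S , g≋h P) })
        , λ Q∈S → let P , P∈S , eq = r Q∈S in P , P∈S , trans (sym (g≋h P)) eq

      τ-injective : ∀ {u v u′ v′} → (∀ P → shiftPoint u v P ≡ shiftPoint u′ v′ P) → (u , v) ≡ (u′ , v′)
      τ-injective {u} {v} {u′} {v′} eq = aff-injective (eq (aff 0# 0#))
        where
        aff-injective : aff (0# + u) (0# + v) ≡ aff (0# + u′) (0# + v′) → (u , v) ≡ (u′ , v′)
        aff-injective eq = cong₂ _,_ (+-cancelˡ 0# (cong x-of eq)) (+-cancelˡ 0# (cong y-of eq))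
          where
          x-of y-of : Point → Carrier
          x-of (aff x y) = x
          x-of _         = 0#
          y-of (aff x y) = y
          y-of _         = 0#

    -- Members of the stabiliser carry proofs but are compared as maps on points. A shift determines
    -- its parameters by the image of the origin, so counting pairs (u , v) suffices.
    shiftStabiliser-order : ∀ {m} → Enumeration (λ (u , v) → τ u v ∈ Fixing S) m →
                            HasOrder (ShiftStabiliser S) m
    shiftStabiliser-order e = record
      { to        = index′
      ; from      = shift
      ; to-cong   = λ {g} {h} → index′-cong {g} {h}
      ; from-cong = λ { refl _ → refl }
      ; inverse   = (λ {i} {g} g≋ → trans (index′-cong {g} {shift i} g≋) (index-at e i _))
                  , λ { {g , (u , v , g≋τ) , fix} refl P → trans
                        (cong (λ (u , v) → shiftPoint u v P) (at-index e (Fixing-resp {g} {τ u v} g≋τ fix)))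
                        (sym (g≋τ P)) }
      }
      where
      shift : Fin _ → ∃ (_∈ ShiftStabiliser S)
      shift i = τ (proj₁ (at e i)) (proj₂ (at e i)) , (_ , _ , λ _ → refl) , at-∈ e i
      index′ : ∃ (_∈ ShiftStabiliser S) → Fin _
      index′ (g , (u , v , g≋τ) , fix) = index e (Fixing-resp {g} {τ u v} g≋τ fix)
      index′-cong : ∀ {g h} → (∀ P → C.to (proj₁ g) P ≡ C.to (proj₁ h) P) → index′ g ≡ index′ h
      index′-cong {_ , (u , v , g≋τ) , _} {_ , (u′ , v′ , h≋τ) , _} g≋h = index-cong e _ _
        (τ-injective λ P → trans (sym (g≋τ P)) (trans (g≋h P) (h≋τ P)))

  -- Inclusion in one direction suffices: a slope and an affine point over 0 recover `a` and `b`,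
  -- and each kind of line has a point avoided by the other kinds.
  pointsOf-injective : ∀ {ℓ ℓ′} → pointsOf ℓ ⊆ pointsOf ℓ′ → ℓ ≡ ℓ′
  pointsOf-injective {L a b} {L a′ b′} sub = cong₂ L (sub {slope a} refl)
    (b≡ (sub {slope a} refl) (sub {aff 0# _} refl))
    where
    b≡ : a ≡ a′ → f (0# + a) - b ≡ f (0# + a′) - b′ → b ≡ b′
    b≡ refl eq = trans (sym (-‿involutive b))
      (trans (cong -_ (+-cancelˡ (f (0# + a)) eq)) (-‿involutive b′))
  pointsOf-injective {L a b} {N′ _}  sub = ⊥-elim (sub {slope a} refl)
  pointsOf-injective {L a b} {L∞}    sub = ⊥-elim (sub {aff 0# _} refl)
  pointsOf-injective {N′ a} {L _ _}  sub = ⊥-elim (sub {∞} tt)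
  pointsOf-injective {N′ a} {N′ a′}  sub = cong N′ (sub {aff a 0#} refl)
  pointsOf-injective {N′ a} {L∞}     sub = ⊥-elim (sub {aff a 0#} refl)
  pointsOf-injective {L∞} {L _ _}    sub = ⊥-elim (sub {∞} tt)
  pointsOf-injective {L∞} {N′ _}     sub = ⊥-elim (sub {slope 0#} tt)
  pointsOf-injective {L∞} {L∞}       sub = refl

  enumerateLines : Line ↔ Fin (N ℕ.* N ℕ.+ (N ℕ.+ 1))
  enumerateLines = ↔-trans sum-of-kinds (↔-trans
    (↔-trans (enumeration ×-↔ enumeration) (↔-sym Fin.*↔×)
      ⊎-↔ ↔-trans (enumeration ⊎-↔ ↔-sym Fin.1↔⊤) (↔-sym Fin.+↔⊎))
    (↔-sym Fin.+↔⊎))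
    where
    sum-of-kinds : Line ↔ ((Carrier × Carrier) ⊎ (Carrier ⊎ ⊤))
    sum-of-kinds = mk↔ₛ′
      (λ { (L a b) → inj₁ (a , b) ; (N′ a) → inj₂ (inj₁ a) ; L∞ → inj₂ (inj₂ tt) })
      (λ { (inj₁ (a , b)) → L a b ; (inj₂ (inj₁ a)) → N′ a ; (inj₂ (inj₂ tt)) → L∞ })
      (λ { (inj₁ (a , b)) → refl ; (inj₂ (inj₁ a)) → refl ; (inj₂ (inj₂ tt)) → refl })
      (λ { (L a b) → refl ; (N′ a) → refl ; L∞ → refl })

  module _ (g : Collineation) where

    private
      module g = Inverse (C.bijection g)

    lineMap : Line → Line
    lineMap ℓ = proj₁ (C.linesOntoLines g ℓ)

    lineMap-∈ : ∀ ℓ {P} → P ∈ pointsOf ℓ → g.to P ∈ pointsOf (lineMap ℓ)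
    lineMap-∈ ℓ {P} P∈ℓ = proj₁ (proj₂ (C.linesOntoLines g ℓ)) (P , P∈ℓ , refl)

    lineMap-∈⁻¹ : ∀ ℓ {P} → g.to P ∈ pointsOf (lineMap ℓ) → P ∈ pointsOf ℓ
    lineMap-∈⁻¹ ℓ {P} gP∈ with P′ , P′∈ℓ , eq ← proj₂ (proj₂ (C.linesOntoLines g ℓ)) gP∈ =
      subst (_∈ pointsOf ℓ) (trans (sym (g.strictlyInverseʳ P′))
        (trans (cong g.from eq) (g.strictlyInverseʳ P))) P′∈ℓ

    lineMap-injective : ∀ {ℓ ℓ′} → lineMap ℓ ≡ lineMap ℓ′ → ℓ ≡ ℓ′
    lineMap-injective {ℓ} {ℓ′} eq = pointsOf-injective λ {P} P∈ℓ →
      lineMap-∈⁻¹ ℓ′ (subst (λ m → g.to P ∈ pointsOf m) eq (lineMap-∈ ℓ P∈ℓ))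

    -- The definition of a collineation does not say that every line is an image. The induced map on
    -- lines is injective and there are finitely many lines, so it is onto.
    lineMap-surjective : ∀ ℓ′ → ∃[ ℓ ] lineMap ℓ ≡ ℓ′
    lineMap-surjective ℓ′ = e.from i , trans (sym (e.strictlyInverseʳ _))
      (trans (cong e.from eq) (e.strictlyInverseʳ ℓ′))
      where
      module e = Inverse enumerateLines
      h : Fin _ → Fin _
      h i = e.to (lineMap (e.from i))
      h-injective : Injective _≡_ _≡_ h
      h-injective {i} {j} eq = trans (sym (e.strictlyInverseˡ i)) (trans (cong e.to
        (lineMap-injective (trans (sym (e.strictlyInverseʳ _))
          (trans (cong e.from eq) (e.strictlyInverseʳ _)))))
        (e.strictlyInverseˡ j))
      hit : ∃[ i ] h i ≡ e.to ℓ′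
      hit = injective⇒surjective h-injective (e.to ℓ′)
      i = proj₁ hit
      eq = proj₂ hit

    collineation⁻¹ : Collineation
    collineation⁻¹ = record
      { bijection      = ↔-sym (C.bijection g)
      ; linesOntoLines = λ ℓ′ → let ℓ , eq = lineMap-surjective ℓ′ in ℓ
          , (λ { (P , P∈ℓ′ , refl) → lineMap-∈⁻¹ ℓ
              (subst₂ (λ Q m → Q ∈ pointsOf m) (sym (g.strictlyInverseˡ P)) (sym eq) P∈ℓ′) })
          , λ {Q} Q∈ℓ → g.to Q , subst (λ m → g.to Q ∈ pointsOf m) eq (lineMap-∈ ℓ Q∈ℓ)
              , g.strictlyInverseʳ Q
      }

  Equivalent-sym : ∀ {S S′} → Equivalent S S′ → Equivalent S′ S
  Equivalent-sym {S} {S′} (g , p , r) = collineation⁻¹ g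
    , (λ { (Q , Q∈S′ , refl) → let P , P∈S , eq = r Q∈S′ in
           subst (_∈ S) (trans (sym (g.strictlyInverseʳ P)) (cong g.from eq)) P∈S })
    , λ {P} P∈S → g.to P , p (P , P∈S , refl) , g.strictlyInverseʳ P
    where module g = Inverse (C.bijection g)

  record Tangent (S : Pred Point 0ℓ) (ℓ : Line) (R : Point) : Set where
    constructor tangent
    field
      on-set  : R ∈ S
      on-line : R ∈ pointsOf ℓ
      unique  : ∀ {R′} → R′ ∈ S → R′ ∈ pointsOf ℓ → R′ ≡ R

  -- The line `m` may depend on the point `P` but not on the tangent through it.
  FeetCollinear : Pred Point 0ℓ → Set
  FeetCollinear S = ∀ P → ∃[ m ] (∀ {ℓ R} → Tangent S ℓ R → P ∈ pointsOf ℓ → R ∈ pointsOf m)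

  -- Tangents are pushed forward along the collineation, and the line containing their feet is
  -- pulled back.
  Equivalent-FeetCollinear : ∀ {S S′} → Equivalent S S′ → FeetCollinear S′ → FeetCollinear S
  Equivalent-FeetCollinear {S} {S′} (g , p , r) feet P = pull (feet (C.to g P)) (lineMap-surjective g _)
    where
    push : ∀ {ℓ R} → Tangent S ℓ R → Tangent S′ (lineMap g ℓ) (C.to g R)
    push {ℓ} {R} (tangent R∈S R∈ℓ unique) = tangent (p (R , R∈S , refl)) (lineMap-∈ g ℓ R∈ℓ)
      λ R′∈S′ R′∈ → let Q , Q∈S , Q≡ = r R′∈S′ in
        trans (sym Q≡) (cong (C.to g) (unique Q∈S
          (lineMap-∈⁻¹ g ℓ (subst (_∈ pointsOf (lineMap g ℓ)) (sym Q≡) R′∈))))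
    pull : (feet′ : ∃[ m ] (∀ {ℓ R} → Tangent S′ ℓ R → C.to g P ∈ pointsOf ℓ → R ∈ pointsOf m)) →
           ∃[ m₀ ] lineMap g m₀ ≡ proj₁ feet′ →
           ∃[ m₀ ] (∀ {ℓ R} → Tangent S ℓ R → P ∈ pointsOf ℓ → R ∈ pointsOf m₀)
    pull (m , R∈m) (m₀ , eq) = m₀ , λ {ℓ} {R} t P∈ℓ →
      lineMap-∈⁻¹ g m₀ (subst (λ m → C.to g R ∈ pointsOf m) (sym eq)
        (R∈m (push t) (lineMap-∈ g ℓ P∈ℓ)))

-- The unital of the polarity

module Unitals (n : ℕ) .{{_ : NonZero n}} (F : FiniteField (3 ℕ.^ (2 ℕ.* n))) where

  open Conjugation n F
  open Solver using (solve; _:+_; _:*_; :-_; _:-_; _:=_; :0; :1)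

  module _ {f : Carrier → Carrier} (twoToOne : TwoToOne f) where

    open TwoToOne twoToOne
    open Plane F f
    open PlaneProperties F f

    aff≡ : ∀ {x y x′ y′} → aff x y ≡ aff x′ y′ → x ≡ x′
    aff≡ refl = refl

    shift-trace : ∀ x {u} → u ∈ TraceZero → x + u + conj (x + u) ≡ x + conj x
    shift-trace x {u} u∈ = begin
      x + u + conj (x + u)          ≡⟨ cong (x + u +_) (conj-+ x u) ⟩
      x + u + (conj x + conj u)     ≡⟨ cong (λ z → x + u + (conj x + z)) (TraceZero⇒conj≡- u∈) ⟩
      x + u + (conj x + - u)
        ≡⟨ solve 3 (λ x u x′ → x :+ u :+ (x′ :+ :- u) := x :+ x′) refl x u (conj x) ⟩
      x + conj x                    ∎

    𝒰-shift : ∀ {u v} → u ∈ TraceZero → v ∈ TraceZero → ∀ {P} → P ∈ 𝒰 q → shiftPoint u v P ∈ 𝒰 q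
    𝒰-shift {u} {v} u∈ v∈ {aff x y} p =
      trans (shift-trace y v∈) (trans p (cong f (sym (shift-trace x u∈))))
    𝒰-shift u∈ v∈ {∞} p = tt

    -- Two points of `𝒰` suffice. With s the trace of u and w the trace of v, the origin gives w = f
    -- s. The point (s , - f s) moves to an x-coordinate of trace - s + s = 0, which gives f s + w =
    -- 0. Hence f s = 0.
    𝒰-fixing : ∀ {u v} → τ u v ∈ Fixing (𝒰 q) → u ∈ TraceZero × v ∈ TraceZero
    𝒰-fixing {u} {v} (fix , _) = f≡0⇒≡0 fs≡0 , trans w≡fs fs≡0
      where
      s w : Carrier
      s = u + conj u
      w = v + conj v
      origin∈𝒰 : aff 0# 0# ∈ 𝒰 q
      origin∈𝒰 = trans (trans (+-identityˡ _) conj-0)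
        (sym (trans (cong f (trans (+-identityˡ _) conj-0)) f0≡0))
      w≡fs : w ≡ f s
      w≡fs = trans (cong₂ _+_ (sym (+-identityˡ v)) (cong conj (sym (+-identityˡ v))))
        (trans (fix (aff 0# 0# , origin∈𝒰 , refl))
        (cong f (cong₂ _+_ (+-identityˡ u) (cong conj (+-identityˡ u)))))
      fs∈𝔽 : conj (f s) ≡ f s
      fs∈𝔽 = trans (sym (f-^ s q)) (cong f (trace∈𝔽 u))
      -- In characteristic 3 the point (s , − f s) lies on 𝒰, and its x-coordinate has trace − s.
      point∈𝒰 : aff s (- f s) ∈ 𝒰 q
      point∈𝒰 = begin
        - f s + conj (- f s)   ≡⟨ cong (- f s +_) (trans (conj-neg (f s)) (cong -_ fs∈𝔽)) ⟩
        - f s + - f s          ≡⟨ solve 1 (λ z → :- z :+ :- z := z) refl (f s) ⟩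
        f s                    ≡⟨ sym (f-even s) ⟩
        f (- s)                ≡⟨ cong f (solve 1 (λ z → :- z := z :+ z) refl s) ⟩
        f (s + s)              ≡⟨ cong (λ z → f (s + z)) (sym (trace∈𝔽 u)) ⟩
        f (s + conj s)         ∎
      fs≡0 : f s ≡ 0#
      fs≡0 = ≡-⇒≡0 (begin
        f s                                     ≡⟨ solve 1 (λ z → z := :- z :+ :- z) refl (f s) ⟩
        - f s + - f s
          ≡⟨ solve 2 (λ z w → :- z :+ :- z := (:- z :+ :- z :+ w) :- w) refl (f s) w ⟩
        (- f s + - f s + w) - w
          ≡⟨ cong (_- w)
             (solve 3 (λ z v v′ → :- z :+ :- z :+ (v :+ v′) := (:- z :+ v) :+ (:- z :+ v′))
                refl (f s) v (conj v)) ⟩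
        ((- f s + v) + (- f s + conj v)) - w
          ≡⟨ cong (λ z → (- f s + v) + (z + conj v) - w) (sym (trans (conj-neg (f s))
             (cong -_ fs∈𝔽))) ⟩
        ((- f s + v) + (conj (- f s) + conj v)) - w
          ≡⟨ cong (λ z → (- f s + v) + z - w) (sym (conj-+ (- f s) v)) ⟩
        ((- f s + v) + conj (- f s + v)) - w
          ≡⟨ cong (_- w) (fix (aff s (- f s) , point∈𝒰 , refl)) ⟩
        f ((s + u) + conj (s + u)) - w
          ≡⟨ cong (λ z → f ((s + u) + z) - w) (trans (conj-+ s u) (cong (_+ conj u) (trace∈𝔽 u))) ⟩
        f ((s + u) + (s + conj u)) - w
          ≡⟨ cong (λ z → f z - w) (solve 2 (λ u u′ → (u :+ u′ :+ u) :+ (u :+ u′ :+ u′) := :0)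
             refl u (conj u)) ⟩
        f 0# - w                                ≡⟨ cong₂ _-_ f0≡0 w≡fs ⟩
        0# - f s                                ≡⟨ +-identityˡ _ ⟩
        - f s                                   ∎)

    -- Conjugating the incidence equation exchanges the two points, because `f` commutes with
    -- conjugation.
    polarity-symmetric : ∀ {x y} P → P ∈ pointsOf (polarity q (aff x y)) →
                         aff x y ∈ pointsOf (polarity q P)
    polarity-symmetric {x} {y} (aff x′ y′) p = begin
      y                                        ≡⟨ sym (conj-involutive y) ⟩
      conj (conj y)
        ≡⟨ solve 2 (λ y y′ → y := (y′ :+ y) :- y′) refl (conj (conj y)) (conj y′) ⟩
      (conj y′ + conj (conj y)) - conj y′      ≡⟨ cong (_- conj y′) (sym (conj-+ y′ (conj y))) ⟩
      conj (y′ + conj y) - conj y′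
        ≡⟨ cong (λ z → conj z - conj y′) (trans (cong (_+ conj y) p)
           (solve 2 (λ a b → a :- b :+ b := a) refl _ (conj y))) ⟩
      conj (f (x′ + conj x)) - conj y′         ≡⟨ cong (_- conj y′) (sym (f-^ _ q)) ⟩
      f (conj (x′ + conj x)) - conj y′
        ≡⟨ cong (λ z → f z - conj y′) (trans (conj-+ x′ (conj x)) (trans
           (cong (conj x′ +_) (conj-involutive x)) (+-comm _ _))) ⟩
      f (x + conj x′) - conj y′                ∎
    polarity-symmetric {x} (slope c) p = trans (sym (conj-involutive x)) (cong conj (sym p))

    -- Two involutions preserve the points of L a b on 𝒰, parametrised by
    -- B = x + a: B ↦ conj B, and on its fixed points B ↦ − B − (a + conj a).
    -- The foot of a tangent is fixed by both.
    𝒰-tangent : ∀ {a b x y} → Tangent (𝒰 q) (L a b) (aff x y) → L a b ≡ polarity q (aff x y)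
    𝒰-tangent {a} {b} {x} {y} (tangent R∈𝒰 R∈L unique) = cong₂ L a≡ b≡
      where
      A s β : Carrier
      A = x + a
      s = a + conj a
      β = b + conj b

      OnUnital : Carrier → Set
      OnUnital B = f B + f (conj B) - β ≡ f (B + conj B - s)

      trace-x : ∀ B → (B - a) + conj (B - a) ≡ B + conj B - s
      trace-x B = trans (cong (B - a +_) (conj-sub B a))
        (solve 4 (λ B B′ a a′ → (B :- a) :+ (B′ :- a′) := B :+ B′ :- (a :+ a′)) refl B (conj B) a (conj a))

      trace-y : ∀ B → (f B - b) + conj (f B - b) ≡ f B + f (conj B) - β
      trace-y B = trans (cong (f B - b +_) (trans (conj-sub (f B) b) (cong (_- conj b) (sym (f-^ B q)))))
        (solve 4 (λ B B′ a a′ → (B :- a) :+ (B′ :- a′) := B :+ B′ :- (a :+ a′))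
           refl (f B) (f (conj B)) b (conj b))

      B≡A : ∀ B → OnUnital B → B ≡ A
      B≡A B on = trans (solve 2 (λ B a → B := B :- a :+ a) refl B a) (cong (_+ a) (aff≡ (unique
        {aff (B - a) (f B - b)} (trans (trace-y B) (trans on (cong f (sym (trace-x B)))))
        (cong (λ z → f z - b) (solve 2 (λ B a → B := B :- a :+ a) refl B a)))))

      A-on : OnUnital A
      A-on = begin
        f A + f (conj A) - β            ≡⟨ sym (trace-y A) ⟩
        (f A - b) + conj (f A - b)      ≡⟨ cong (λ z → z + conj z) (sym R∈L) ⟩
        y + conj y                      ≡⟨ R∈𝒰 ⟩
        f (x + conj x)
          ≡⟨ cong (λ z → f (z + conj z)) (solve 2 (λ x a → x := x :+ a :- a) refl x a) ⟩
        f (A - a + conj (A - a))        ≡⟨ cong f (trace-x A) ⟩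
        f (A + conj A - s)              ∎

      A∈𝔽 : conj A ≡ A
      A∈𝔽 = B≡A (conj A) (begin
        f (conj A) + f (conj (conj A)) - β
          ≡⟨ cong (λ z → f (conj A) + f z - β) (conj-involutive A) ⟩
        f (conj A) + f A - β                  ≡⟨ cong (_- β) (+-comm _ _) ⟩
        f A + f (conj A) - β                  ≡⟨ A-on ⟩
        f (A + conj A - s)
          ≡⟨ cong (λ z → f (z - s)) (trans (+-comm _ _) (cong (conj A +_)
             (sym (conj-involutive A)))) ⟩
        f (conj A + conj (conj A) - s)        ∎)

      f[A+s] : f A + f A - β ≡ f (A + s)
      f[A+s] = begin
        f A + f A - β           ≡⟨ cong (λ z → f A + f z - β) (sym A∈𝔽) ⟩
        f A + f (conj A) - β    ≡⟨ A-on ⟩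
        f (A + conj A - s)      ≡⟨ cong (λ z → f (A + z - s)) A∈𝔽 ⟩
        f (A + A - s)           ≡⟨ cong f (solve 2 (λ A s → A :+ A :- s := :- (A :+ s)) refl A s) ⟩
        f (- (A + s))           ≡⟨ f-even (A + s) ⟩
        f (A + s)               ∎

      B : Carrier
      B = - (A + s)

      B∈𝔽 : conj B ≡ B
      B∈𝔽 = 𝔽-neg (𝔽-+ A∈𝔽 (trace∈𝔽 a))

      -- Modulo 3, f B = 2 f A - β gives f B + f B - β = f A, while B + B - s = A; so `B` satisfies
      -- the equation as well.
      -[A+s]≡A : B ≡ A
      -[A+s]≡A = B≡A B (begin
        f B + f (conj B) - β                  ≡⟨ cong (λ z → f B + f z - β) B∈𝔽 ⟩
        f B + f B - β
          ≡⟨ cong (λ z → z + z - β) (trans (f-even (A + s)) (sym f[A+s])) ⟩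
        (f A + f A - β) + (f A + f A - β) - β
          ≡⟨ solve 2 (λ z β → (z :+ z :- β) :+ (z :+ z :- β) :- β := z) refl (f A) β ⟩
        f A
          ≡⟨ cong f (solve 2 (λ A s → A := :- (A :+ s) :+ :- (A :+ s) :- s) refl A s) ⟩
        f (B + B - s)                         ≡⟨ cong (λ z → f (B + z - s)) (sym B∈𝔽) ⟩
        f (B + conj B - s)                    ∎)

      -- In characteristic 3, - (A + s) = A means A = s, that is, x + a = a + conj a.
      x≡ : x ≡ conj a
      x≡ = begin
        x
          ≡⟨ solve 3 (λ x a s → x := :- (x :+ a :+ s) :- (x :+ a) :+ (s :- a)) refl x a s ⟩
        B - A + (s - a)              ≡⟨ cong (λ z → z - A + (s - a)) -[A+s]≡A ⟩
        A - A + (s - a)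
          ≡⟨ solve 3 (λ A a a′ → A :- A :+ (a :+ a′ :- a) := a′) refl A a (conj a) ⟩
        conj a                       ∎

      a≡ : a ≡ conj x
      a≡ = trans (sym (conj-involutive a)) (cong conj (sym x≡))

      b≡ : b ≡ conj y
      b≡ = begin
        b                        ≡⟨ solve 2 (λ b z → b := z :- (z :- b)) refl b (f A) ⟩
        f A - (f A - b)          ≡⟨ cong₂ (λ z w → f (x + z) - w) a≡ (sym R∈L) ⟩
        f (x + conj x) - y       ≡⟨ cong (_- y) (sym R∈𝒰) ⟩
        y + conj y - y           ≡⟨ solve 2 (λ y z → y :+ z :- y := z) refl y (conj y) ⟩
        conj y                   ∎

    𝒰-feetCollinear : FeetCollinear (𝒰 q)
    𝒰-feetCollinear P = polarity q P , λ {ℓ} {R} → foot∈polar ℓ R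
      where
      foot∈polar : ∀ ℓ R → Tangent (𝒰 q) ℓ R → P ∈ pointsOf ℓ → R ∈ pointsOf (polarity q P)
      foot∈polar (L a b) (aff x y) t P∈ℓ =
        polarity-symmetric P (subst (λ ℓ → P ∈ pointsOf ℓ) (𝒰-tangent t) P∈ℓ)
      -- Never a tangent: besides `∞` this line carries a point of `𝒰` with y-coordinate - f (a +
      -- conj a).
      foot∈polar (N′ a) R (tangent _ _ unique) _ =
        contradiction (trans (unique {∞} tt tt) (sym (unique {aff a (- z)} on refl))) λ ()
        where
        z : Carrier
        z = f (a + conj a)
        on : aff a (- z) ∈ 𝒰 q
        on = trans (cong (- z +_) (trans (conj-neg z) (cong -_
            (trans (sym (f-^ _ q)) (cong f (trace∈𝔽 a))))))
          (solve 1 (λ z → :- z :+ :- z := z) refl z)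
      -- The foot is `∞`, which lies on the polar of every point at infinity.
      foot∈polar L∞ R (tangent _ _ unique) P∈ℓ =
        subst (_∈ pointsOf (polarity q P)) (unique {∞} tt tt) (∞∈ P P∈ℓ)
        where
        ∞∈ : ∀ P → P ∈ pointsOf L∞ → ∞ ∈ pointsOf (polarity q P)
        ∞∈ (slope a) _ = tt
        ∞∈ ∞         _ = tt

    -- The stabiliser consists of the shifts with both parameters of trace zero. Here `θ` enters
    -- through `δ`, which serves to count them.
    𝒰-order : {θ : Carrier} → θ ≢ 0# → ¬ SquareIn (𝔽 q) (θ ^ (q ℕ.+ 1)) →
              HasOrder (ShiftStabiliser (𝒰 q)) (3 ℕ.^ (2 ℕ.* n))
    𝒰-order {θ} θ≢0 nonsquare = shiftStabiliser-order (Enumeration-transport id id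
      (λ (u∈ , v∈) → τ-fixing (𝒰-shift u∈ v∈) (𝒰-shift (TraceZero-neg u∈) (TraceZero-neg v∈)))
      𝒰-fixing (λ _ → refl) (λ _ → refl) (Nonsquare.enumerate-TraceZero² θ θ≢0 nonsquare))

    -- The unital `𝒰[ θ ]` and inequivalence

    module _ (θ : Carrier) (θ≢0 : θ ≢ 0#) (nonsquare : ¬ SquareIn (𝔽 q) (θ ^ (q ℕ.+ 1))) where

      open Nonsquare θ θ≢0 nonsquare

      𝒰[θ]-shift : ∀ {u v} → v ∈ 𝔽θ → ∀ {P} → P ∈ 𝒰[ θ ] q → shiftPoint u v P ∈ 𝒰[ θ ] q
      𝒰[θ]-shift v∈ {aff x y} y∈ = 𝔽θ-+ y∈ v∈
      𝒰[θ]-shift v∈ {∞}       _  = tt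

      -- All q² values of u are allowed, and the image of the origin confines v to the q elements of
      -- `𝔽θ`.
      𝒰[θ]-order : HasOrder (ShiftStabiliser (𝒰[ θ ] q)) (3 ℕ.^ (3 ℕ.* n))
      𝒰[θ]-order = subst (HasOrder (ShiftStabiliser (𝒰[ θ ] q))) size
        (shiftStabiliser-order (Enumeration-transport {P = U ⟨×⟩ 𝔽θ} id id
          (λ (_ , v∈) → τ-fixing (𝒰[θ]-shift v∈) (𝒰[θ]-shift (𝔽θ-neg v∈)))
          (λ {(u , v)} (fix , _) → tt , subst (_∈ 𝔽θ) (+-identityˡ v) (fix (aff 0# 0# , 0∈𝔽θ , refl)))
          (λ _ → refl) (λ _ → refl) (Enumeration-× elements enumerate-𝔽θ)))
        where
        size : 3 ℕ.^ (2 ℕ.* n) ℕ.* q ≡ 3 ℕ.^ (3 ℕ.* n)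
        size = trans (sym (ℕ.^-distribˡ-+-* 3 (2 ℕ.* n) n)) (cong (3 ℕ.^_) (ℕ.+-comm (2 ℕ.* n) n))

      𝒰[θ]-tangent : ∀ a {b} → b ∈ 𝔽θ → Tangent (𝒰[ θ ] q) (L a b) (aff (- a) (- b))
      𝒰[θ]-tangent a {b} b∈ = tangent (𝔽θ-neg b∈) (sym (f[-a+a]-b (-‿inverseˡ a))) λ {R} → unique R
        where
        f[-a+a]-b : ∀ {z} → z ≡ 0# → f z - b ≡ - b
        f[-a+a]-b z≡0 = trans (cong (_- b) (trans (cong f z≡0) f0≡0)) (+-identityˡ _)
        unique : ∀ R → R ∈ 𝒰[ θ ] q → R ∈ pointsOf (L a b) → R ≡ aff (- a) (- b)
        unique (aff x y) y∈ y≡ = cong₂ aff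
          (trans (solve 2 (λ x a → x := (x :+ a) :- a) refl x a)
            (trans (cong (_- a) x+a≡0) (+-identityˡ _)))
          (trans y≡ (f[-a+a]-b x+a≡0))
          where
          x+a≡0 : x + a ≡ 0#
          x+a≡0 = f∈𝔽θ⇒≡0 twoToOne (subst (_∈ 𝔽θ)
            (trans (cong (_+ b) y≡) (solve 2 (λ z b → z :- b :+ b := z) refl _ b)) (𝔽θ-+ y∈ b∈))

      𝒰[θ]-feetNotCollinear : ¬ FeetCollinear (𝒰[ θ ] q)
      𝒰[θ]-feetNotCollinear feet = three-feet (f-congruent twoToOne)
        where
        three-feet : ¬ (∃₂ λ a b → a ≢ 0# × a ≢ b × a ≢ - b × f a - f b ∈ 𝔽θ)
        -- The tangents through (0 , f a) are L a 0, L (- a) 0 and L b (f b - f a), with feet (- a ,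
        -- 0), (a , 0) and (- b , f a - f b).
        three-feet (a , b , a≢0 , a≢b , a≢-b , fa-fb∈) = not-on m
            (foot∈m (𝒰[θ]-tangent a 0∈𝔽θ) (f[0+ a ]-0 refl))
            (foot∈m (𝒰[θ]-tangent (- a) 0∈𝔽θ) (f[0+ - a ]-0 (sym (f-even a))))
            (foot∈m (𝒰[θ]-tangent b (𝔽θ-neg fa-fb∈)) (trans
              (solve 2 (λ z w → z := w :- :- (z :- w)) refl (f a) (f b))
              (cong (λ z → f z - - (f a - f b)) (sym (+-identityˡ b)))))
          where
          m = proj₁ (feet (aff 0# (f a)))
          foot∈m : ∀ {ℓ R} → Tangent (𝒰[ θ ] q) ℓ R → aff 0# (f a) ∈ pointsOf ℓ → R ∈ pointsOf m
          foot∈m = proj₂ (feet (aff 0# (f a)))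
          f[0+_]-0 : ∀ c {z} → z ≡ f c → z ≡ f (0# + c) - 0#
          f[0+ c ]-0 eq = trans eq (trans (cong f (sym (+-identityˡ c)))
            (solve 1 (λ z → z := z :- :0) refl _))
          not-on : ∀ m → aff (- a) (- 0#) ∈ pointsOf m → aff (- - a) (- 0#) ∈ pointsOf m →
                   aff (- b) (- - (f a - f b)) ∈ pointsOf m → ⊥
          not-on (N′ c) p₁ p₂ _ = a≢0 (trans (sym (-‿involutive a)) (≡-⇒≡0
            (trans p₂ (trans (sym p₁) (sym (-‿involutive (- a)))))))
          -- The feet of height 0 give f (- a + c) = e = f (a + c). Equal arguments force a = 0;
          -- opposite ones force c = 0 and e = f a.
          not-on (L c e) p₁ p₂ p₃ with f-injective± (trans (f≡e p₁) (sym (f≡e p₂)))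
            where
            f≡e : ∀ {z} → - 0# ≡ z - e → z ≡ e
            f≡e p = -≡0⇒≡ (trans (sym p) -0#≈0#)
          ... | inj₁ eq = a≢0 (≡-⇒≡0 (trans (sym (-‿involutive a)) (trans
                (solve 2 (λ a c → :- (:- a) := :- (:- a) :+ c :- c) refl a c) (trans (cong (_- c) (sym eq))
                (solve 2 (λ a c → :- a :+ c :- c := :- a) refl a c)))))
          -- With c = 0 and e = f a the third foot gives f a - f b = f b - f a, hence f a = f b,
          -- contrary to the choice of a and b.
          ... | inj₂ eq = [ a≢b , a≢-b ]′ (f-injective± (-≡0⇒≡ (≡-⇒≡0 (begin
                f a - f b                    ≡⟨ solve 1 (λ z → z := :- (:- z)) refl _ ⟩
                - - (f a - f b)              ≡⟨ p₃ ⟩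
                f (- b + c) - e              ≡⟨ cong₂ (λ z w → z - w) (f-+c b) e≡ ⟩
                f b - f a
                  ≡⟨ solve 2 (λ z w → w :- z := :- (z :- w)) refl (f a) (f b) ⟩
                - (f a - f b)                ∎))))
            where
            c≡0 : c ≡ 0#
            c≡0 = ≡-⇒≡0 (begin
              c                       ≡⟨ solve 2 (λ a c → c := :- a :+ c :+ a) refl a c ⟩
              - a + c + a             ≡⟨ cong (_+ a) eq ⟩
              - (- - a + c) + a
                ≡⟨ solve 2 (λ a c → :- (:- (:- a) :+ c) :+ a := :- c) refl a c ⟩
              - c                     ∎)
            f-+c : ∀ z → f (- z + c) ≡ f z
            f-+c z = trans (cong f (trans (cong (- z +_) c≡0) (+-identityʳ _))) (f-even z)
            e≡ : e ≡ f a
            e≡ = trans (sym (-≡0⇒≡ (trans (sym p₁) -0#≈0#))) (f-+c a)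

      𝒰≁𝒰[θ] : ¬ Equivalent (𝒰 q) (𝒰[ θ ] q) × ¬ Equivalent (𝒰[ θ ] q) (𝒰 q)
      𝒰≁𝒰[θ] = inequivalent ∘ Equivalent-sym , inequivalent
        where
        inequivalent : ¬ Equivalent (𝒰[ θ ] q) (𝒰 q)
        inequivalent eq = 𝒰[θ]-feetNotCollinear (Equivalent-FeetCollinear eq 𝒰-feetCollinear)

open import Data.Nat using (_+_; _*_; _^_)

theorem4p6 : (n : ℕ) .{{_ : NonZero n}} (F : FiniteField (3 ^ (2 * n)))
    (k : ℕ) → gcd k (2 * n) ≡ 1 →
    (θ : FiniteField.Carrier F) → θ ≢ FiniteField.0# F →
    let module K = FiniteField F
        module Π = Plane F (coulterMatthews F k)
        q = 3 ^ n
    in ¬ K.SquareIn (K.𝔽 q) (θ K.^ (q + 1)) →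
       Π.HasOrder (Π.ShiftStabiliser (Π.𝒰 q)) (3 ^ (2 * n))
     × Π.HasOrder (Π.ShiftStabiliser (Π.𝒰[ θ ] q)) (3 ^ (3 * n))
     × ¬ Π.Equivalent (Π.𝒰 q) (Π.𝒰[ θ ] q)
     × ¬ Π.Equivalent (Π.𝒰[ θ ] q) (Π.𝒰 q)
theorem4p6 n F k coprime θ θ≢0 nonsquare =
    𝒰-order cm θ≢0 nonsquare , 𝒰[θ]-order cm θ θ≢0 nonsquare , 𝒰≁𝒰[θ] cm θ θ≢0 nonsquare
  where
  open Unitals n F
  cm : Characteristic3.TwoToOne {2 * n} F (coulterMatthews F k)
  cm = Characteristic3.CoulterMatthews.twoToOne {2 * n} F k coprime (ℕ.m∣m*n n)
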